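{- Let $\alpha_k$ be defined by $\alpha_k=q^{3r^2+r}$ if $k=3r-1$, $\alpha_k=q^{3r^2-r}$ if $k=3r$, $\alpha_k=-q^{3r^2+r}-q^{3r^2+5r+2}$ if $k=3r+1$. Then for every integer $p\ge1$, every positive integer $N$ and every primitive $N$th root of unity $q$, $$H_p^{(3)}(q)=q^{ -1}\sum_{k=0}^{N-1}(-1)^kq^{\binom{k+1}{2}+(p-1)(k^2+k)}\alpha_k.$$
   Context: $(a)_n=\prod_{k=1}^n(1-aq^{k-1})$, $\begin{bmatrix} n\\ k\end{bmatrix}=\frac{(q)_n}{(q)_{n-k}(q)_k}$. $H_p^{(3)}(q)=\sum_{n_p\ge\cdots\ge n_1\ge0}q^{2n_p}(q^{n_p+1})_{n_p}\prod_{i=1}^{p-1}q^{n_i(n_i+1)}\begin{bmatrix} n_{i+1}\\ n_i\end{bmatrix}$; at a root of unity only finitely many terms are nonzero. -}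

module Defs where

open import Level using (Level)
open import Data.Nat as ℕ using (ℕ; zero; suc)
open import Data.Nat.DivMod using (_%_)
open import Data.Product using (_×_)
open import Data.Sum using (_⊎_)
open import Relation.Nullary using (¬_)
open import Algebra.Bundles using (CommutativeRing)

module _ {c ℓ : Level} (R : CommutativeRing c ℓ) where
  open CommutativeRing R

  pow : Carrier → ℕ → Carrier
  pow x zero = 1#
  pow x (suc n) = x * pow x n

  sumTo : ℕ → (ℕ → Carrier) → Carrier
  sumTo zero f = 0#
  sumTo (suc n) f = sumTo n f + f n

  sgn : ℕ → Carrier
  sgn zero = 1#
  sgn (suc k) = - sgn k

  IsIntegralDomain : Set (c Level.⊔ ℓ)
  IsIntegralDomain = (¬ (1# ≈ 0#)) × (∀ x y → x * y ≈ 0# → (x ≈ 0#) ⊎ (y ≈ 0#))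

  IsPrimitiveRoot : ℕ → Carrier → Set ℓ
  IsPrimitiveRoot N q = (pow q N ≈ 1#) × (∀ k → 0 ℕ.< k → k ℕ.< N → ¬ (pow q k ≈ 1#))

  module _ (q : Carrier) where

    qPoch : Carrier → ℕ → Carrier
    qPoch a zero = 1#
    qPoch a (suc n) = qPoch a n * (1# - a * pow q n)

    -- Gaussian binomial coefficient [n choose k] as a polynomial in q
    -- (q-Pascal recursion; equals (q)_n / ((q)_{n-k} (q)_k) as polynomials)
    qBinom : ℕ → ℕ → Carrier
    qBinom n zero = 1#
    qBinom zero (suc k) = 0#
    qBinom (suc n) (suc k) = qBinom n k + pow q (suc k) * qBinom n (suc k)

    -- inner j m = Σ over chains m ≥ n_j ≥ ... ≥ n_1 ≥ 0 of
    --   ∏ q^{n_i(n_i+1)} [n_{i+1} choose n_i]   (with n_{j+1} = m)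
    inner : ℕ → ℕ → Carrier
    inner zero m = 1#
    inner (suc j) m =
      sumTo (suc m) (λ n → pow q (n ℕ.* suc n) * qBinom m n * inner j n)

    Hpartial : ℕ → ℕ → Carrier
    Hpartial p M =
      sumTo M (λ m → pow q (2 ℕ.* m) * qPoch (pow q (suc m)) m * inner (p ℕ.∸ 1) m)

    alpha : ℕ → Carrier
    alpha k with k % 3
    ... | 0 = pow q (3 ℕ.* r ℕ.* r ℕ.∸ r)
      where r = k ℕ./ 3
    ... | 1 = - (pow q (3 ℕ.* r ℕ.* r ℕ.+ r)
                 + pow q (3 ℕ.* r ℕ.* r ℕ.+ 5 ℕ.* r ℕ.+ 2))
      where r = k ℕ./ 3
    ... | _ = pow q (3 ℕ.* r ℕ.* r ℕ.+ r)                     -- k = 3r-1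
      where r = suc (k ℕ./ 3)

    rhsSum : ℕ → ℕ → Carrier
    rhsSum p N = sumTo N (λ k →
      sgn k * pow q ((k ℕ.* suc k) ℕ./ 2 ℕ.+ (p ℕ.∸ 1) ℕ.* (k ℕ.* k ℕ.+ k)) * alpha k)

{-# OPTIONS --safe #-}

-- Write b(m,k) = [2m, m+k] and D(m,k) = b(m,k) − q^(2k+1) b(m,k+1).  Applying Bailey's lemma
-- relative to a = q repeatedly to the unit Bailey pair gives, as polynomials in q,
--   (q^(m+1))_m · inner j m = ∑_k (−1)^k q^(k(k−1)/2 + (j+1)(k²+k)) D(m,k);
-- every step is an identity between q-binomials, since factors 1 − q^i cannot be cancelled at a
-- root of unity.  As q^m D(m,k) = q^k (b(m,k) − b(m,k+1)), the sum of q^(2m) D(m,k) over m < N is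
-- q^k (X k − X (k+1)) with X k = ∑_{m<N} q^m b(m,k).  A telescoping relation between b(m,k),
-- b(m,k+3) and b(m+1,·) turns into X k ~ X (k+3) up to a power of q when q is a primitive N-th
-- root of unity, because b(N,k) = 0 for 0 < k < N.  Starting from X N = 0 this evaluates every
-- X k and shows that the k-th summand of q · H is the (N−1−k)-th summand on the right: the period
-- 3 of X is the case distinction in the definition of α.
module Submission where

open import Defs
open import Level using (Level)
open import Algebra.Bundles using (CommutativeRing; RawRing)
import Algebra.Properties.AbelianGroup as AbelianGroupProperties
import Algebra.Properties.CommutativeSemigroup as CommutativeSemigroupProperties
import Algebra.Properties.Ring as RingProperties
import Algebra.Properties.Semiring.Mult.TCOptimised as Multiples
import Algebra.Solver.Ring
open import Algebra.Solver.Ring.AlmostCommutativeRing using (_-Raw-AlmostCommutative⟶_; fromCommutativeRing)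
open import Data.Maybe using (Maybe; just; nothing)
open import Data.Nat as ℕ using (ℕ; zero; suc; z≤n; s≤s; _≤_; _<_; _≥_)
import Data.Nat.Divisibility as ℕ
import Data.Nat.DivMod as ℕ
import Data.Nat.Properties as ℕ
import Data.Nat.Solver as ℕ-Solver
open import Data.Product using (_×_; _,_; ∃-syntax; proj₁; proj₂)
open import Data.Sum using (_⊎_; inj₁; inj₂)
open import Relation.Nullary using (¬_; yes; no; contradiction)
open import Relation.Binary.PropositionalEquality as ≡ using (_≡_)
import Relation.Binary.Reasoning.Setoid as SetoidReasoning

-- Relative to a = q, β_m = inner j m / (q)_m belongs to a Bailey pair, and (q)_{2m} β_m =
-- (q^(m+1))_m · inner j m. Thus the Pochhammer symbol already present in H is the one that clears
-- every denominator. All the α_k of these pairs contain (1 - q^(2k+1))/(1 - q); merged with the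
-- kernel (q)_{2m} / ((q)_{m-k} (q^2)_{m+k}) it gives D(m,k), a polynomial. Each classical quotient
-- identity is recast as a polynomial identity and certified as an ideal membership, the binomial
-- input being mostly the ratio of neighbouring binomials. The root of unity enters late and in
-- three ways: q becomes invertible, b(N,k) = 0 for 0 < k < N (here zero divisors must be excluded),
-- and k(k+1) is invariant modulo N under k ↦ N-1-k. With i = N - k as index, N disappears from the
-- exponents of X k, which is why α does not depend on N.

module DifferenceSolver {c ℓ : Level} (R : CommutativeRing c ℓ) where
  open CommutativeRing R
  open RingProperties ring using (-‿distribˡ-*; -‿distribʳ-*; -0#≈0#)
  open AbelianGroupProperties +-abelianGroup using (⁻¹-∙-comm; ⁻¹-involutive)
  open CommutativeSemigroupProperties +-commutativeSemigroup using (interchange)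
  open Multiples semiring renaming (_×_ to _·_)
  open SetoidReasoning setoid

  -- The coefficient (a , b) stands for the integer a − b, so that the solver can decide
  -- cancellation although R itself has no decidable equality.  The clause b = 0 is
  -- separate in order that con (1 , 0) means 1# on the nose.
  ⟦_⟧ : ℕ × ℕ → Carrier
  ⟦ a , zero ⟧  = a · 1#
  ⟦ a , suc b ⟧ = a · 1# - suc b · 1#

  ⟦⟧-difference : ∀ a b → ⟦ a , b ⟧ ≈ a · 1# - b · 1#
  ⟦⟧-difference a zero    = sym (trans (+-congˡ -0#≈0#) (+-identityʳ _))
  ⟦⟧-difference a (suc b) = refl

  minus-plus : ∀ x y z w → (x + z) - (y + w) ≈ (x - y) + (z - w)
  minus-plus x y z w = trans (+-congˡ (sym (⁻¹-∙-comm y w))) (interchange x z (- y) (- w))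

  minus-times : ∀ x y z w → (x * z + y * w) - (x * w + y * z) ≈ (x - y) * (z - w)
  minus-times x y z w = sym (begin
    (x - y) * (z - w)                             ≈⟨ distribˡ _ _ _ ⟩
    (x - y) * z + (x - y) * - w                   ≈⟨ +-cong (distribʳ _ _ _) (distribʳ _ _ _) ⟩
    (x * z + - y * z) + (x * - w + - y * - w)     ≈⟨ +-congˡ (+-comm _ _) ⟩
    (x * z + - y * z) + (- y * - w + x * - w)     ≈⟨ interchange _ _ _ _ ⟩
    (x * z + - y * - w) + (- y * z + x * - w)     ≈⟨ +-cong (+-congˡ neg-neg) (+-cong (sym (-‿distribˡ-* y z)) (sym (-‿distribʳ-* x w))) ⟩
    (x * z + y * w) + (- (y * z) + - (x * w))     ≈⟨ +-congˡ (trans (⁻¹-∙-comm _ _) (-‿cong (+-comm _ _))) ⟩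
    (x * z + y * w) - (x * w + y * z)             ∎)
    where
    neg-neg : - y * - w ≈ y * w
    neg-neg = trans (sym (-‿distribˡ-* y (- w))) (trans (-‿cong (sym (-‿distribʳ-* y w))) (⁻¹-involutive _))

  differences : RawRing _ _
  differences = record
    { Carrier = ℕ × ℕ
    ; _≈_     = _≡_
    ; _+_     = λ { (a , b) (c , d) → a ℕ.+ c , b ℕ.+ d }
    ; _*_     = λ { (a , b) (c , d) → a ℕ.* c ℕ.+ b ℕ.* d , a ℕ.* d ℕ.+ b ℕ.* c }
    ; -_      = λ { (a , b) → b , a }
    ; 0#      = 0 , 0
    ; 1#      = 1 , 0
    }

  evaluation : differences -Raw-AlmostCommutative⟶ fromCommutativeRing R
  evaluation = record
    { ⟦_⟧    = ⟦_⟧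
    ; +-homo = λ { (a , b) (c , d) → begin
        ⟦ a ℕ.+ c , b ℕ.+ d ⟧                      ≈⟨ ⟦⟧-difference _ (b ℕ.+ d) ⟩
        (a ℕ.+ c) · 1# - (b ℕ.+ d) · 1#            ≈⟨ +-cong (×-homo-+ 1# a c) (-‿cong (×-homo-+ 1# b d)) ⟩
        (a · 1# + c · 1#) - (b · 1# + d · 1#)      ≈⟨ minus-plus _ _ _ _ ⟩
        (a · 1# - b · 1#) + (c · 1# - d · 1#)      ≈⟨ +-cong (⟦⟧-difference a b) (⟦⟧-difference c d) ⟨
        ⟦ a , b ⟧ + ⟦ c , d ⟧                      ∎ }
    ; *-homo = λ { (a , b) (c , d) → begin
        ⟦ a ℕ.* c ℕ.+ b ℕ.* d , a ℕ.* d ℕ.+ b ℕ.* c ⟧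
          ≈⟨ ⟦⟧-difference _ (a ℕ.* d ℕ.+ b ℕ.* c) ⟩
        (a ℕ.* c ℕ.+ b ℕ.* d) · 1# - (a ℕ.* d ℕ.+ b ℕ.* c) · 1#
          ≈⟨ +-cong (sum-of-products a c b d) (-‿cong (sum-of-products a d b c)) ⟩
        (a · 1# * c · 1# + b · 1# * d · 1#) - (a · 1# * d · 1# + b · 1# * c · 1#)
          ≈⟨ minus-times _ _ _ _ ⟩
        (a · 1# - b · 1#) * (c · 1# - d · 1#)
          ≈⟨ *-cong (⟦⟧-difference a b) (⟦⟧-difference c d) ⟨
        ⟦ a , b ⟧ * ⟦ c , d ⟧ ∎ }
    ; -‿homo = λ { (a , b) → begin
        ⟦ b , a ⟧                     ≈⟨ ⟦⟧-difference b a ⟩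
        b · 1# - a · 1#               ≈⟨ +-congʳ (⁻¹-involutive _) ⟨
        - (- (b · 1#)) - a · 1#       ≈⟨ ⁻¹-∙-comm _ _ ⟩
        - (- (b · 1#) + a · 1#)       ≈⟨ -‿cong (+-comm _ _) ⟩
        - (a · 1# - b · 1#)           ≈⟨ -‿cong (⟦⟧-difference a b) ⟨
        - ⟦ a , b ⟧                   ∎ }
    ; 0-homo = refl
    ; 1-homo = refl
    }
    where
    sum-of-products : ∀ a b c d → (a ℕ.* b ℕ.+ c ℕ.* d) · 1# ≈ a · 1# * b · 1# + c · 1# * d · 1#
    sum-of-products a b c d = trans (×-homo-+ 1# (a ℕ.* b) (c ℕ.* d)) (+-cong (×1-homo-* a b) (×1-homo-* c d))

  -- Pairs are never reduced, so an integer has many representatives. Comparing `a + d` with `c + b`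
  -- identifies them all; otherwise the solver would miss cancellations.
  equal? : ∀ x y → Maybe (⟦ x ⟧ ≈ ⟦ y ⟧)
  equal? (a , b) (c , d) with a ℕ.+ d ℕ.≟ c ℕ.+ b
  ... | no _ = nothing
  ... | yes a+d≡c+b = just (begin
    ⟦ a , b ⟧                                    ≈⟨ ⟦⟧-difference a b ⟩
    a · 1# - b · 1#                              ≈⟨ cancel-common (d · 1#) ⟨
    (a · 1# + d · 1#) - (b · 1# + d · 1#)        ≈⟨ +-congʳ (×-homo-+ 1# a d) ⟨
    (a ℕ.+ d) · 1# - (b · 1# + d · 1#)           ≈⟨ +-congʳ (×-cong a+d≡c+b refl) ⟩
    (c ℕ.+ b) · 1# - (b · 1# + d · 1#)           ≈⟨ +-cong (×-homo-+ 1# c b) (-‿cong (+-comm _ _)) ⟩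
    (c · 1# + b · 1#) - (d · 1# + b · 1#)        ≈⟨ cancel-common (b · 1#) ⟩
    c · 1# - d · 1#                              ≈⟨ ⟦⟧-difference c d ⟨
    ⟦ c , d ⟧                                    ∎)
    where
    cancel-common : ∀ {x y} z → (x + z) - (y + z) ≈ x - y
    cancel-common z = trans (minus-plus _ _ z z) (trans (+-congˡ (-‿inverseʳ z)) (+-identityʳ _))

  open Algebra.Solver.Ring differences (fromCommutativeRing R) evaluation equal? public
    using (solve; _:=_; _:+_; _:*_; _:-_; :-_; con; Polynomial)

  :1 : ∀ {n} → Polynomial n
  :1 = con (1 , 0)

  :0 : ∀ {n} → Polynomial n
  :0 = con (0 , 0)

-- Gaussian binomials and Pochhammer symbols without division.

module GaussianBinomials {c ℓ : Level} (R : CommutativeRing c ℓ) (q : CommutativeRing.Carrier R) where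
  open CommutativeRing R hiding (zero)
  open DifferenceSolver R
  open SetoidReasoning setoid

  infix 10 q^_

  q^_ : ℕ → Carrier
  q^ n = pow R q n

  [_,_] : ℕ → ℕ → Carrier
  [ n , k ] = qBinom R q n k

  ⟨_⟩_ : Carrier → ℕ → Carrier
  ⟨ a ⟩ n = qPoch R q a n

  -- Uses a hypothesis u ≈ v with cofactor t, so that a nest of such steps around one call of
  -- the solver is an ideal-membership certificate.
  modulo : ∀ {x y u v} → u ≈ v → ∀ t → x ≈ y + t * (u - v) → x ≈ y
  modulo {x} {y} {u} {v} u≈v t x≈ = begin
    x                  ≈⟨ x≈ ⟩
    y + t * (u - v)    ≈⟨ +-congˡ (*-congˡ (+-congʳ u≈v)) ⟩
    y + t * (v - v)    ≈⟨ solve 3 (λ y t v → y :+ t :* (v :- v) := y) refl y t v ⟩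
    y                  ∎

  pow-+ : ∀ x m n → pow R x (m ℕ.+ n) ≈ pow R x m * pow R x n
  pow-+ x zero    n = sym (*-identityˡ _)
  pow-+ x (suc m) n = trans (*-congˡ (pow-+ x m n)) (sym (*-assoc _ _ _))

  pow-cong : ∀ {x y} n → x ≈ y → pow R x n ≈ pow R y n
  pow-cong zero    x≈y = refl
  pow-cong (suc n) x≈y = *-cong x≈y (pow-cong n x≈y)

  pow-* : ∀ x y n → pow R (x * y) n ≈ pow R x n * pow R y n
  pow-* x y zero    = sym (*-identityˡ 1#)
  pow-* x y (suc n) = trans (*-congˡ (pow-* x y n))
    (solve 4 (λ x y z w → x :* y :* (z :* w) := x :* z :* (y :* w)) refl _ _ _ _)

  pow-pow : ∀ x m n → pow R (pow R x m) n ≈ pow R x (n ℕ.* m)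
  pow-pow x m zero    = refl
  pow-pow x m (suc n) = trans (*-congˡ (pow-pow x m n)) (sym (pow-+ x m (n ℕ.* m)))

  q^-cong : ∀ {m n} → m ≡ n → q^ m ≈ q^ n
  q^-cong m≡n = reflexive (≡.cong q^_ m≡n)

  binom-congˡ : ∀ {m n} k → m ≡ n → [ m , k ] ≈ [ n , k ]
  binom-congˡ k m≡n = reflexive (≡.cong [_, k ] m≡n)

  binom-congʳ : ∀ n {k l} → k ≡ l → [ n , k ] ≈ [ n , l ]
  binom-congʳ n k≡l = reflexive (≡.cong [ n ,_] k≡l)

  binom-zero : ∀ {n k} → n < k → [ n , k ] ≈ 0#
  binom-zero {zero}  {suc k} _         = refl
  binom-zero {suc n} {suc k} (s≤s n<k) = begin
    [ n , k ] + q^ suc k * [ n , suc k ]  ≈⟨ +-cong (binom-zero n<k) (*-congˡ (binom-zero (ℕ.m<n⇒m<1+n n<k))) ⟩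
    0# + q^ suc k * 0#                    ≈⟨ trans (+-identityˡ _) (zeroʳ _) ⟩
    0#                                    ∎

  binom-diagonal : ∀ n → [ n , n ] ≈ 1#
  binom-diagonal zero    = refl
  binom-diagonal (suc n) = begin
    [ n , n ] + q^ suc n * [ n , suc n ]  ≈⟨ +-cong (binom-diagonal n) (*-congˡ (binom-zero (ℕ.n<1+n n))) ⟩
    1# + q^ suc n * 0#                    ≈⟨ trans (+-congˡ (zeroʳ _)) (+-identityʳ _) ⟩
    1#                                    ∎

  -- `b` stands for n - a, which keeps truncated subtraction out. The inductive step needs the
  -- identity at two neighbouring entries of the previous row. `binom-pascal′`, `binom-raise` and
  -- `binom-absorb` are then polynomial consequences.
  binom-ratio : ∀ {n} a b → a ℕ.+ b ≡ n →
                (1# - q^ b) * [ n , a ] ≈ (1# - q^ suc a) * [ n , suc a ]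
  binom-ratio a zero ≡.refl = begin
    (1# - 1#) * [ a ℕ.+ 0 , a ]                ≈⟨ trans (*-congʳ (-‿inverseʳ 1#)) (zeroˡ _) ⟩
    0#                                         ≈⟨ zeroʳ _ ⟨
    (1# - q^ suc a) * 0#                       ≈⟨ *-congˡ (binom-zero (s≤s (ℕ.≤-reflexive (ℕ.+-identityʳ a)))) ⟨
    (1# - q^ suc a) * [ a ℕ.+ 0 , suc a ]      ∎
  binom-ratio zero (suc b) ≡.refl = modulo (binom-ratio zero b ≡.refl) q
    (solve 3 (λ q B x → (:1 :- q :* B) :* :1
       := (:1 :- q :* :1) :* (:1 :+ q :* :1 :* x) :+ q :* ((:1 :- B) :* :1 :- (:1 :- q :* :1) :* x))
     refl q (q^ b) [ b , 1 ])
  binom-ratio (suc a) (suc b) ≡.refl =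
    modulo (binom-ratio a (suc b) ≡.refl) 1#
    (modulo (binom-ratio (suc a) b (≡.sym (ℕ.+-suc a b))) (q * (q * q^ a))
    (solve 6 (λ q A B u v w →
       (:1 :- q :* B) :* (u :+ q :* A :* v)
       := (:1 :- q :* (q :* A)) :* (v :+ q :* (q :* A) :* w)
          :+ :1 :* ((:1 :- q :* B) :* u :- (:1 :- q :* A) :* v)
          :+ q :* (q :* A) :* ((:1 :- B) :* v :- (:1 :- q :* (q :* A)) :* w))
     refl q (q^ a) (q^ b) _ _ _))

  binom-pascal′ : ∀ {n} a b → a ℕ.+ b ≡ n →
                  [ suc n , suc a ] ≈ q^ b * [ n , a ] + [ n , suc a ]
  binom-pascal′ {n} a b a+b≡n = modulo (binom-ratio a b a+b≡n) 1#
    (solve 4 (λ A B x y → x :+ A :* y := B :* x :+ y :+ :1 :* ((:1 :- B) :* x :- (:1 :- A) :* y))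
     refl (q^ suc a) (q^ b) [ n , a ] [ n , suc a ])

  binom-raise : ∀ {n} a b → a ℕ.+ b ≡ n →
                (1# - q^ suc b) * [ suc n , a ] ≈ (1# - q^ suc n) * [ n , a ]
  binom-raise {n} a b ≡.refl =
    modulo (binom-ratio a (suc b) (ℕ.+-suc a b)) 1#
    (modulo (binom-ratio a b ≡.refl) (- (q^ suc a))
    (modulo (pow-+ q a b) (q * [ n , a ])
    (solve 7 (λ q A B AB x y z →
       (:1 :- q :* B) :* z
       := (:1 :- q :* AB) :* x
          :+ :1 :* ((:1 :- q :* B) :* z :- (:1 :- q :* A) :* (x :+ q :* A :* y))
          :+ :- (q :* A) :* ((:1 :- B) :* x :- (:1 :- q :* A) :* y)
          :+ q :* x :* (AB :- A :* B))
     refl q (q^ a) (q^ b) (q^ n) [ n , a ] [ n , suc a ] [ suc n , a ])))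

  binom-absorb : ∀ {n} a b → a ℕ.+ b ≡ n →
                 (1# - q^ suc a) * [ suc n , suc a ] ≈ (1# - q^ suc n) * [ n , a ]
  binom-absorb {n} a b ≡.refl =
    modulo (binom-ratio a b ≡.refl) (- (q^ suc a))
    (modulo (pow-+ q (suc a) b) [ n , a ]
    (solve 5 (λ A B AB x y →
       (:1 :- A) :* (x :+ A :* y)
       := (:1 :- AB) :* x
         :+ :- A :* ((:1 :- B) :* x :- (:1 :- A) :* y)
         :+ x :* (AB :- A :* B))
     refl (q^ suc a) (q^ b) (q^ suc n) [ n , a ] [ n , suc a ]))

  -- The ratio of consecutive binomials without the truncated exponent n ∸ k, hence also
  -- valid beyond the diagonal.
  binom-ratio-shifted : ∀ n k e f → f ℕ.+ k ≡ e ℕ.+ n →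
    (q^ e - q^ f) * [ n , k ] ≈ q^ e * (1# - q^ suc k) * [ n , suc k ]
  binom-ratio-shifted n k e f f+k≡e+n with k ℕ.≤? n
  ... | yes k≤n =
    modulo (binom-ratio k d (ℕ.m+[n∸m]≡n k≤n)) (q^ e)
    (modulo (trans (q^-cong f≡e+d) (pow-+ q e d)) (- [ n , k ])
    (solve 6 (λ E F D K x y → (E :- F) :* x
        := E :* (:1 :- K) :* y :+ E :* ((:1 :- D) :* x :- (:1 :- K) :* y) :+ (:- x) :* (F :- E :* D))
      refl (q^ e) (q^ f) (q^ d) (q^ suc k) [ n , k ] [ n , suc k ]))
    where
    d : ℕ
    d = n ℕ.∸ k
    f≡e+d : f ≡ e ℕ.+ d
    f≡e+d = ℕ.+-cancelʳ-≡ k f (e ℕ.+ d) (≡.trans f+k≡e+n (≡.trans (≡.cong (e ℕ.+_) (≡.sym (ℕ.m∸n+n≡m k≤n))) (≡.sym (ℕ.+-assoc e d k))))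
  ... | no k≰n = begin
    (q^ e - q^ f) * [ n , k ]                     ≈⟨ trans (*-congˡ (binom-zero n<k)) (zeroʳ _) ⟩
    0#                                            ≈⟨ trans (*-congˡ (binom-zero (ℕ.m<n⇒m<1+n n<k))) (zeroʳ _) ⟨
    q^ e * (1# - q^ suc k) * [ n , suc k ]        ∎
    where
    n<k : n < k
    n<k = ℕ.≰⇒> k≰n

  -- Exchanging a and b interchanges the two q-Pascal rules: the defining one on the left becomes
  -- `binom-pascal′` on the right.
  binom-sym : ∀ {n} a b → a ℕ.+ b ≡ n → [ n , a ] ≈ [ n , b ]
  binom-sym zero    b       ≡.refl = sym (binom-diagonal b)
  binom-sym (suc a) zero    ≡.refl =
    trans (binom-congˡ (suc a) (≡.cong suc (ℕ.+-identityʳ a))) (binom-diagonal (suc a))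
  binom-sym {n} (suc a) (suc b) ≡.refl = begin
    [ n′ , a ] + q^ suc a * [ n′ , suc a ]
      ≈⟨ +-cong (binom-sym a (suc b) ≡.refl) (*-congˡ (binom-sym (suc a) b (≡.sym (ℕ.+-suc a b)))) ⟩
    [ n′ , suc b ] + q^ suc a * [ n′ , b ]
      ≈⟨ +-comm _ _ ⟩
    q^ suc a * [ n′ , b ] + [ n′ , suc b ]
      ≈⟨ binom-pascal′ b (suc a) (≡.trans (ℕ.+-comm b (suc a)) (≡.sym (ℕ.+-suc a b))) ⟨
    [ n , suc b ] ∎
    where
    n′ : ℕ
    n′ = a ℕ.+ suc b

  -- Both sides are the q-multinomial coefficient of a, b, c. The q-Pascal rule splits each into
  -- three terms, in each of which one of a, b, c is lowered, and the induction closes term by term.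
  trinomial-revision : ∀ {n s t} a b c → a ℕ.+ b ≡ s → b ℕ.+ c ≡ t → s ℕ.+ c ≡ n →
                       [ n , s ] * [ s , a ] ≈ [ n , a ] * [ t , b ]
  trinomial-revision zero b c ≡.refl ≡.refl ≡.refl = *-comm _ _
  trinomial-revision {n} (suc a) zero c ≡.refl ≡.refl ≡.refl =
    *-cong (binom-congʳ n (ℕ.+-identityʳ (suc a)))
           (trans (binom-congˡ (suc a) (ℕ.+-identityʳ (suc a))) (binom-diagonal (suc a)))
  trinomial-revision {n} {s} (suc a) (suc b) zero ≡.refl ≡.refl ≡.refl = begin
    [ n , s ] * [ s , suc a ]                    ≈⟨ *-cong (trans (binom-congˡ s n≡s) (binom-diagonal s)) (binom-congˡ (suc a) (≡.sym n≡s)) ⟩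
    1# * [ n , suc a ]                           ≈⟨ *-comm _ _ ⟩
    [ n , suc a ] * 1#                           ≈⟨ *-congˡ (trans (binom-congˡ (suc b) (ℕ.+-identityʳ (suc b))) (binom-diagonal (suc b))) ⟨
    [ n , suc a ] * [ suc b ℕ.+ 0 , suc b ]      ∎
    where
    n≡s : n ≡ s
    n≡s = ℕ.+-identityʳ s
  trinomial-revision (suc a) (suc b) (suc c) ≡.refl ≡.refl ≡.refl =
    modulo (trinomial-revision a (suc b) (suc c) ≡.refl ≡.refl ≡.refl) 1#
    (modulo (trinomial-revision (suc a) b (suc c) (≡.sym (ℕ.+-suc a b)) ≡.refl ≡.refl) (q^ suc a)
    (modulo (trinomial-revision (suc a) (suc b) c ≡.refl (≡.sym (ℕ.+-suc b c)) (≡.sym (ℕ.+-suc (a ℕ.+ suc b) c))) (q^ suc a * q^ suc b)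
    (modulo (pow-+ q (suc a) (suc b)) ([ N , suc M ] * [ suc M , suc a ])
    (solve 11 (λ A B AB N,M N,M′ N,a N,a′ M,a M,a′ K,b K,b′ →
       (N,M :+ AB :* N,M′) :* (M,a :+ A :* M,a′)
       := (N,a :+ A :* N,a′) :* (K,b :+ B :* K,b′)
          :+ :1 :* (N,M :* M,a :- N,a :* (K,b :+ B :* K,b′))
          :+ A :* (N,M :* M,a′ :- N,a′ :* K,b)
          :+ A :* B :* (N,M′ :* (M,a :+ A :* M,a′) :- N,a′ :* K,b′)
          :+ N,M′ :* (M,a :+ A :* M,a′) :* (AB :- A :* B))
     refl (q^ suc a) (q^ suc b) (q^ suc M) [ N , M ] [ N , suc M ] [ N , a ] [ N , suc a ] [ M , a ] [ M , suc a ]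
       [ b ℕ.+ suc c , b ] [ b ℕ.+ suc c , suc b ]))))
    where
    M N : ℕ
    M = a ℕ.+ suc b
    N = M ℕ.+ suc c

  -- Both sides are the q-multinomial coefficient of a, b, c, d.
  multinomial-exchange : ∀ {n s t s′ t′} a b c d →
    a ℕ.+ b ≡ s → c ℕ.+ d ≡ t → s ℕ.+ t ≡ n → a ℕ.+ c ≡ s′ → b ℕ.+ d ≡ t′ →
    [ n , s ] * [ s , a ] * [ t , c ] ≈ [ n , s′ ] * [ s′ , a ] * [ t′ , b ]
  multinomial-exchange {n} {s} {t} {s′} {t′} a b c d ≡.refl ≡.refl ≡.refl ≡.refl ≡.refl = begin
    [ n , s ] * [ s , a ] * [ t , c ]             ≈⟨ *-congʳ (trinomial-revision a b t ≡.refl ≡.refl ≡.refl) ⟩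
    [ n , a ] * [ u , b ] * [ t , c ]             ≈⟨ *-assoc _ _ _ ⟩
    [ n , a ] * ([ u , b ] * [ t , c ])           ≈⟨ *-congˡ (trinomial-revision b c d ≡.refl ≡.refl (ℕ.+-assoc b c d)) ⟨
    [ n , a ] * ([ u , v ] * [ v , b ])           ≈⟨ *-congˡ (*-congˡ (binom-sym b c ≡.refl)) ⟩
    [ n , a ] * ([ u , v ] * [ v , c ])           ≈⟨ *-congˡ (trinomial-revision c b d (ℕ.+-comm c b) ≡.refl (ℕ.+-assoc b c d)) ⟩
    [ n , a ] * ([ u , c ] * [ t′ , b ])          ≈⟨ *-assoc _ _ _ ⟨
    [ n , a ] * [ u , c ] * [ t′ , b ]            ≈⟨ *-congʳ (trinomial-revision a c t′ ≡.refl c+t′≡u s′+t′≡n) ⟨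
    [ n , s′ ] * [ s′ , a ] * [ t′ , b ]          ∎
    where
    u v : ℕ
    u = b ℕ.+ t
    v = b ℕ.+ c
    open ℕ-Solver.+-*-Solver using () renaming (solve to ℕ-solve; _:+_ to _⊕_; _:=_ to _⊜_)
    c+t′≡u : c ℕ.+ t′ ≡ u
    c+t′≡u = ℕ-solve 3 (λ b c d → c ⊕ (b ⊕ d) ⊜ b ⊕ (c ⊕ d)) ≡.refl b c d
    s′+t′≡n : s′ ℕ.+ t′ ≡ n
    s′+t′≡n = ℕ-solve 4 (λ a b c d → (a ⊕ c) ⊕ (b ⊕ d) ⊜ (a ⊕ b) ⊕ (c ⊕ d)) ≡.refl a b c d

  poch-cong : ∀ {x y} n → x ≈ y → ⟨ x ⟩ n ≈ ⟨ y ⟩ n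
  poch-cong zero    x≈y = refl
  poch-cong (suc n) x≈y = *-cong (poch-cong n x≈y) (+-congˡ (-‿cong (*-congʳ x≈y)))

  poch-split : ∀ x m n → ⟨ x ⟩ (m ℕ.+ n) ≈ ⟨ x ⟩ m * ⟨ x * q^ m ⟩ n
  poch-split x m zero = begin
    ⟨ x ⟩ (m ℕ.+ 0)   ≈⟨ reflexive (≡.cong ⟨ x ⟩_ (ℕ.+-identityʳ m)) ⟩
    ⟨ x ⟩ m           ≈⟨ *-identityʳ _ ⟨
    ⟨ x ⟩ m * 1#      ∎
  poch-split x m (suc n) = begin
    ⟨ x ⟩ (m ℕ.+ suc n)
      ≈⟨ reflexive (≡.cong ⟨ x ⟩_ (ℕ.+-suc m n)) ⟩
    ⟨ x ⟩ (m ℕ.+ n) * (1# - x * q^ (m ℕ.+ n))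
      ≈⟨ *-cong (poch-split x m n) (+-congˡ (-‿cong (trans (*-congˡ (pow-+ q m n)) (sym (*-assoc _ _ _))))) ⟩
    ⟨ x ⟩ m * ⟨ x * q^ m ⟩ n * (1# - x * q^ m * q^ n)
      ≈⟨ *-assoc _ _ _ ⟩
    ⟨ x ⟩ m * ⟨ x * q^ m ⟩ suc n ∎

  poch-head : ∀ x n → ⟨ x ⟩ suc n ≈ (1# - x) * ⟨ x * q ⟩ n
  poch-head x n = begin
    ⟨ x ⟩ suc n                             ≈⟨ poch-split x 1 n ⟩
    1# * (1# - x * 1#) * ⟨ x * q^ 1 ⟩ n     ≈⟨ *-cong (trans (*-identityˡ _) (+-congˡ (-‿cong (*-identityʳ x)))) (poch-cong n (*-congˡ (*-identityʳ q))) ⟩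
    (1# - x) * ⟨ x * q ⟩ n                  ∎

  -- `⟨ q^ 1 ⟩ b` is (q)_b, so this is (q)_n / (q)_a freed of its quotient. In the induction on b,
  -- `binom-raise` accounts for the new factor on the left.
  poch-binom : ∀ {n} a b → a ℕ.+ b ≡ n → ⟨ q^ suc a ⟩ b ≈ [ n , a ] * ⟨ q^ 1 ⟩ b
  poch-binom a zero ≡.refl = begin
    1#                      ≈⟨ binom-diagonal a ⟨
    [ a , a ]               ≈⟨ binom-congˡ a (ℕ.+-identityʳ a) ⟨
    [ a ℕ.+ 0 , a ]         ≈⟨ *-identityʳ _ ⟨
    [ a ℕ.+ 0 , a ] * 1#    ∎
  poch-binom {n} a (suc b) ≡.refl =
    modulo (poch-binom a b ≡.refl) (1# - q^ suc a * q^ b)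
    (modulo (binom-raise a b ≡.refl) (- (⟨ q^ 1 ⟩ b))
    (modulo (pow-+ q a b) (q * [ a ℕ.+ b , a ] * ⟨ q^ 1 ⟩ b)
    (modulo (binom-congˡ a (≡.sym (ℕ.+-suc a b))) ((1# - q^ suc b) * ⟨ q^ 1 ⟩ b)
    (solve 9 (λ q A B AB x y y′ P F →
       P :* (:1 :- q :* A :* B)
       := y′ :* (F :* (:1 :- q :* :1 :* B))
         :+ (:1 :- q :* A :* B) :* (P :- x :* F)
         :+ (:- F) :* ((:1 :- q :* B) :* y :- (:1 :- q :* AB) :* x)
         :+ q :* x :* F :* (AB :- A :* B)
         :+ (:1 :- q :* B) :* F :* (y :- y′))
      refl q (q^ a) (q^ b) (q^ (a ℕ.+ b)) [ a ℕ.+ b , a ] [ suc (a ℕ.+ b) , a ] [ a ℕ.+ suc b , a ]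
        (⟨ q^ suc a ⟩ b) (⟨ q^ 1 ⟩ b)))))

  factorial-binom : ∀ {n} a b → a ℕ.+ b ≡ n → ⟨ q^ 1 ⟩ n ≈ [ n , a ] * ⟨ q^ 1 ⟩ a * ⟨ q^ 1 ⟩ b
  factorial-binom {n} a b ≡.refl = begin
    ⟨ q^ 1 ⟩ n                                  ≈⟨ poch-split (q^ 1) a b ⟩
    ⟨ q^ 1 ⟩ a * ⟨ q^ 1 * q^ a ⟩ b              ≈⟨ *-congˡ (poch-cong b (sym (pow-+ q 1 a))) ⟩
    ⟨ q^ 1 ⟩ a * ⟨ q^ suc a ⟩ b                 ≈⟨ *-congˡ (poch-binom a b ≡.refl) ⟩
    ⟨ q^ 1 ⟩ a * ([ n , a ] * ⟨ q^ 1 ⟩ b)       ≈⟨ solve 3 (λ x y z → x :* (y :* z) := y :* x :* z) refl _ _ _ ⟩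
    [ n , a ] * ⟨ q^ 1 ⟩ a * ⟨ q^ 1 ⟩ b         ∎

-- Finite sums.

module Sums {c ℓ : Level} (R : CommutativeRing c ℓ) where
  open CommutativeRing R hiding (zero)
  open DifferenceSolver R
  open SetoidReasoning setoid

  Σ< : ℕ → (ℕ → Carrier) → Carrier
  Σ< = sumTo R

  sum-cong : ∀ n {f g : ℕ → Carrier} → (∀ i → i < n → f i ≈ g i) → Σ< n f ≈ Σ< n g
  sum-cong zero    f≈g = refl
  sum-cong (suc n) f≈g = +-cong (sum-cong n (λ i i<n → f≈g i (ℕ.m<n⇒m<1+n i<n))) (f≈g n (ℕ.n<1+n n))

  sum-zero : ∀ n {f : ℕ → Carrier} → (∀ i → i < n → f i ≈ 0#) → Σ< n f ≈ 0#
  sum-zero zero    f≈0 = refl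
  sum-zero (suc n) f≈0 = trans (+-cong (sum-zero n (λ i i<n → f≈0 i (ℕ.m<n⇒m<1+n i<n))) (f≈0 n (ℕ.n<1+n n))) (+-identityˡ 0#)

  sum-+ : ∀ n f g → Σ< n (λ i → f i + g i) ≈ Σ< n f + Σ< n g
  sum-+ zero    f g = sym (+-identityˡ 0#)
  sum-+ (suc n) f g = trans (+-congʳ (sum-+ n f g))
    (solve 4 (λ w x y z → (w :+ x) :+ (y :+ z) := (w :+ y) :+ (x :+ z)) refl _ _ _ _)

  sum-*ˡ : ∀ n x f → x * Σ< n f ≈ Σ< n (λ i → x * f i)
  sum-*ˡ zero    x f = zeroʳ x
  sum-*ˡ (suc n) x f = trans (distribˡ _ _ _) (+-congʳ (sum-*ˡ n x f))

  sum-swap : ∀ m n (f : ℕ → ℕ → Carrier) →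
             Σ< m (λ i → Σ< n (f i)) ≈ Σ< n (λ j → Σ< m (λ i → f i j))
  sum-swap zero    n f = sym (sum-zero n (λ _ _ → refl))
  sum-swap (suc m) n f = trans (+-congʳ (sum-swap m n f)) (sym (sum-+ n _ _))

  sum-split : ∀ m n f → Σ< (m ℕ.+ n) f ≈ Σ< m f + Σ< n (λ i → f (m ℕ.+ i))
  sum-split m zero f = begin
    Σ< (m ℕ.+ 0) f   ≈⟨ reflexive (≡.cong (λ k → Σ< k f) (ℕ.+-identityʳ m)) ⟩
    Σ< m f           ≈⟨ +-identityʳ _ ⟨
    Σ< m f + 0#      ∎
  sum-split m (suc n) f = begin
    Σ< (m ℕ.+ suc n) f                                        ≈⟨ reflexive (≡.cong (λ k → Σ< k f) (ℕ.+-suc m n)) ⟩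
    Σ< (m ℕ.+ n) f + f (m ℕ.+ n)                              ≈⟨ +-congʳ (sum-split m n f) ⟩
    Σ< m f + Σ< n (λ i → f (m ℕ.+ i)) + f (m ℕ.+ n)           ≈⟨ +-assoc _ _ _ ⟩
    Σ< m f + Σ< (suc n) (λ i → f (m ℕ.+ i))                   ∎

  sum-head : ∀ n f → Σ< (suc n) f ≈ f 0 + Σ< n (λ i → f (suc i))
  sum-head n f = trans (sum-split 1 n f) (+-congʳ (+-identityˡ (f 0)))

  sum-reverse : ∀ n {f g : ℕ → Carrier} → (∀ i j → i ℕ.+ suc j ≡ n → f i ≈ g j) → Σ< n f ≈ Σ< n g
  sum-reverse zero    f≈g = refl
  sum-reverse (suc n) {f} {g} f≈g = begin
    Σ< n f + f n                        ≈⟨ +-cong (sum-reverse n (λ i j i+1+j≡n → f≈g i (suc j) (≡.trans (ℕ.+-suc i (suc j)) (≡.cong suc i+1+j≡n)))) (f≈g n 0 (ℕ.+-comm n 1)) ⟩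
    Σ< n (λ i → g (suc i)) + g 0        ≈⟨ +-comm _ _ ⟩
    g 0 + Σ< n (λ i → g (suc i))        ≈⟨ sum-head n g ⟨
    Σ< (suc n) g                        ∎

  sum-telescope : ∀ n (f : ℕ → Carrier) → Σ< n (λ i → f i - f (suc i)) ≈ f 0 - f n
  sum-telescope zero    f = sym (-‿inverseʳ (f 0))
  sum-telescope (suc n) f = trans (+-congʳ (sum-telescope n f))
    (solve 3 (λ x y z → (x :- y) :+ (y :- z) := x :- z) refl _ _ _)

  sum-truncate : ∀ {m n} {f : ℕ → Carrier} → n ≤ m → (∀ i → n ≤ i → f i ≈ 0#) → Σ< m f ≈ Σ< n f
  sum-truncate {m} {n} {f} n≤m f≈0 = begin
    Σ< m f                                            ≈⟨ reflexive (≡.cong (λ k → Σ< k f) (ℕ.m+[n∸m]≡n n≤m)) ⟨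
    Σ< (n ℕ.+ (m ℕ.∸ n)) f                            ≈⟨ sum-split n (m ℕ.∸ n) f ⟩
    Σ< n f + Σ< (m ℕ.∸ n) (λ i → f (n ℕ.+ i))         ≈⟨ +-congˡ (sum-zero (m ℕ.∸ n) (λ i _ → f≈0 (n ℕ.+ i) (ℕ.m≤m+n n i))) ⟩
    Σ< n f + 0#                                       ≈⟨ +-identityʳ _ ⟩
    Σ< n f                                            ∎

-- The Bailey chain relative to a = q, with cleared denominators.

module BaileyChain {c ℓ : Level} (R : CommutativeRing c ℓ) (q : CommutativeRing.Carrier R) where
  open CommutativeRing R hiding (zero)
  open DifferenceSolver R
  open GaussianBinomials R q
  open Sums R
  open SetoidReasoning setoid
  open ℕ-Solver.+-*-Solver using () renaming (solve to ℕ-solve; _:+_ to _⊕_; _:*_ to _⊛_; _:=_ to _⊜_; con to ℕ-con)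

  central : ℕ → ℕ → Carrier
  central m k = [ m ℕ.+ m , m ℕ.+ k ]

  -- (1 − q^(2k+1)) (q)_{2m} / ((q)_{m−k} (q)_{m+k+1}), written as a polynomial.
  ballot : ℕ → ℕ → Carrier
  ballot m k = central m k - q^ suc (k ℕ.+ k) * central m (suc k)

  central-zero : ∀ {m k} → m < k → central m k ≈ 0#
  central-zero {m} m<k = binom-zero (ℕ.+-monoʳ-< m m<k)

  ballot-zero : ∀ {m k} → m < k → ballot m k ≈ 0#
  ballot-zero {m} {k} m<k = begin
    central m k - q^ suc (k ℕ.+ k) * central m (suc k)   ≈⟨ +-cong (central-zero m<k) (-‿cong (*-congˡ (central-zero (ℕ.m<n⇒m<1+n m<k)))) ⟩
    0# - q^ suc (k ℕ.+ k) * 0#                           ≈⟨ solve 1 (λ x → :0 :- x :* :0 := :0) refl _ ⟩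
    0#                                                   ∎

  -- [m,n] (q^(m+1))_m / (q^(n+1))_n
  chain-factor : ℕ → ℕ → ℕ → Carrier
  chain-factor m n d = [ m ℕ.+ m , n ℕ.+ n ] * ⟨ q^ suc d ⟩ d

  -- The multinomial coefficient of the table with rows (n, d) and (n, d) is read by rows and by
  -- columns: [2m,m] [m,n]² = [2m,2n] [2n,n] [2d,d]. The factorials (q)_n and (q)_d then turn the
  -- central binomials into Pochhammer symbols.
  chain-factor-spec : ∀ {m} n d → n ℕ.+ d ≡ m →
    [ m , n ] * ⟨ q^ suc m ⟩ m ≈ ⟨ q^ suc n ⟩ n * chain-factor m n d
  chain-factor-spec {m} n d n+d≡m = begin
    [ m , n ] * ⟨ q^ suc m ⟩ m
      ≈⟨ *-congˡ (trans (poch-binom m m ≡.refl) (*-congˡ (factorial-binom n d n+d≡m))) ⟩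
    [ m , n ] * ([ m ℕ.+ m , m ] * ([ m , n ] * n! * d!))
      ≈⟨ solve 4 (λ x y z w → x :* (y :* (x :* z :* w)) := y :* x :* x :* z :* w) refl _ _ _ _ ⟩
    [ m ℕ.+ m , m ] * [ m , n ] * [ m , n ] * n! * d!
      ≈⟨ *-congʳ (*-congʳ (multinomial-exchange n d n d n+d≡m n+d≡m ≡.refl ≡.refl ≡.refl)) ⟩
    [ m ℕ.+ m , n ℕ.+ n ] * [ n ℕ.+ n , n ] * [ d ℕ.+ d , d ] * n! * d!
      ≈⟨ solve 5 (λ x y z u v → x :* y :* z :* u :* v := (y :* u) :* (x :* (z :* v))) refl _ _ _ _ _ ⟩
    ([ n ℕ.+ n , n ] * n!) * ([ m ℕ.+ m , n ℕ.+ n ] * ([ d ℕ.+ d , d ] * d!))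
      ≈⟨ *-cong (poch-binom n n ≡.refl) (*-congˡ (poch-binom d d ≡.refl)) ⟨
    ⟨ q^ suc n ⟩ n * chain-factor m n d ∎
    where
    n! d! : Carrier
    n! = ⟨ q^ 1 ⟩ n
    d! = ⟨ q^ 1 ⟩ d

  -- The same exchange for the table with rows (i, n + k) and (d, d). Its column sums are m - k and
  -- m + k, whence `central m k`.
  chain-factor-central : ∀ {m n} k i d → k ℕ.+ i ≡ n → n ℕ.+ d ≡ m →
    chain-factor m n d * central n k ≈ central m k * [ i ℕ.+ d , i ] * ⟨ q^ suc (n ℕ.+ k) ⟩ d
  chain-factor-central {m} {n} k i d ≡.refl ≡.refl = begin
    [ m ℕ.+ m , n ℕ.+ n ] * ⟨ q^ suc d ⟩ d * [ n ℕ.+ n , n ℕ.+ k ]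
      ≈⟨ *-cong (*-congˡ (poch-binom d d ≡.refl)) (binom-sym (n ℕ.+ k) i n+k+i) ⟩
    [ m ℕ.+ m , n ℕ.+ n ] * ([ d ℕ.+ d , d ] * d!) * [ n ℕ.+ n , i ]
      ≈⟨ solve 4 (λ x y z w → x :* (y :* z) :* w := x :* w :* y :* z) refl _ _ _ _ ⟩
    [ m ℕ.+ m , n ℕ.+ n ] * [ n ℕ.+ n , i ] * [ d ℕ.+ d , d ] * d!
      ≈⟨ *-congʳ (multinomial-exchange i (n ℕ.+ k) d d i+[n+k] ≡.refl n+n+d+d ≡.refl ≡.refl) ⟩
    [ m ℕ.+ m , i ℕ.+ d ] * [ i ℕ.+ d , i ] * [ n ℕ.+ k ℕ.+ d , n ℕ.+ k ] * d!
      ≈⟨ *-assoc _ _ _ ⟩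
    [ m ℕ.+ m , i ℕ.+ d ] * [ i ℕ.+ d , i ] * ([ n ℕ.+ k ℕ.+ d , n ℕ.+ k ] * d!)
      ≈⟨ *-cong (*-congʳ (binom-sym (i ℕ.+ d) (m ℕ.+ k) i+d+m+k)) (sym (poch-binom (n ℕ.+ k) d ≡.refl)) ⟩
    central m k * [ i ℕ.+ d , i ] * ⟨ q^ suc (n ℕ.+ k) ⟩ d ∎
    where
    d! : Carrier
    d! = ⟨ q^ 1 ⟩ d
    n+k+i : n ℕ.+ k ℕ.+ i ≡ n ℕ.+ n
    n+k+i = ℕ.+-assoc n k i
    i+[n+k] : i ℕ.+ (n ℕ.+ k) ≡ n ℕ.+ n
    i+[n+k] = ≡.trans (ℕ.+-comm i (n ℕ.+ k)) n+k+i
    n+n+d+d : n ℕ.+ n ℕ.+ (d ℕ.+ d) ≡ m ℕ.+ m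
    n+n+d+d = ℕ-solve 2 (λ n d → n ⊕ n ⊕ (d ⊕ d) ⊜ n ⊕ d ⊕ (n ⊕ d)) ≡.refl n d
    i+d+m+k : i ℕ.+ d ℕ.+ (m ℕ.+ k) ≡ m ℕ.+ m
    i+d+m+k = ℕ-solve 3 (λ k i d → i ⊕ d ⊕ (k ⊕ i ⊕ d ⊕ k) ⊜ k ⊕ i ⊕ d ⊕ (k ⊕ i ⊕ d)) ≡.refl k i d

  -- `y` is [i + d - 1, i - 1], read as 0 for i = 0. Later only its ratio to [i + d, i] matters, so
  -- it stays anonymous and the two cases share one interface.
  chain-factor-central-suc : ∀ {m n} k i d → k ℕ.+ i ≡ n → n ℕ.+ d ≡ m →
    ∃[ y ] (1# - q^ (i ℕ.+ d)) * y ≈ (1# - q^ i) * [ i ℕ.+ d , i ]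
         × chain-factor m n d * central n (suc k) ≈ central m (suc k) * y * ⟨ q^ suc (suc (n ℕ.+ k)) ⟩ d
  chain-factor-central-suc {n = n} k zero d ≡.refl ≡.refl =
    0# ,
    solve 2 (λ x y → (:1 :- x) :* :0 := (:1 :- :1) :* y) refl _ _ ,
    trans (*-congˡ (central-zero (s≤s (ℕ.≤-reflexive (ℕ.+-identityʳ k)))))
          (solve 3 (λ x y z → x :* :0 := y :* :0 :* z) refl _ _ _)
  chain-factor-central-suc {n = n} k (suc i) d ≡.refl ≡.refl =
    [ i ℕ.+ d , i ] ,
    sym (binom-absorb i d ≡.refl) ,
    trans (chain-factor-central (suc k) i d (≡.sym (ℕ.+-suc k i)) ≡.refl)
          (*-congˡ (poch-cong d (q^-cong (≡.cong suc (ℕ.+-suc n k)))))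

  -- After the common Pochhammer factors are removed, 1 - q^(m+k+1) trades `central m (suc k)` for
  -- `central m k` at the price of 1 - q^(m-k), and this factor relates `y` to [i + d, i]. What is
  -- left cancels because q^(n+k+1) = q^(2k+1) q^i. The case d = 0 is apart since the common factors
  -- have length d - 1.
  chain-factor-ballot : ∀ {m n} k i d → k ℕ.+ i ≡ n → n ℕ.+ d ≡ m →
    chain-factor m n d * ballot n k ≈ ballot m k * ([ i ℕ.+ d , i ] * ⟨ q^ suc (suc (n ℕ.+ k)) ⟩ d)
  chain-factor-ballot {n = n} k i zero ≡.refl ≡.refl = begin
    [ n ℕ.+ 0 ℕ.+ (n ℕ.+ 0) , n ℕ.+ n ] * 1# * ballot n k
      ≈⟨ *-congʳ (trans (*-identityʳ _) (trans (binom-congˡ (n ℕ.+ n) (≡.cong (λ x → x ℕ.+ x) (ℕ.+-identityʳ n))) (binom-diagonal (n ℕ.+ n)))) ⟩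
    1# * ballot n k
      ≈⟨ *-comm _ _ ⟩
    ballot n k * 1#
      ≈⟨ *-cong (reflexive (≡.cong (λ x → ballot x k) (ℕ.+-identityʳ n))) (trans (*-identityʳ _) (trans (binom-congˡ i (ℕ.+-identityʳ i)) (binom-diagonal i))) ⟨
    ballot (n ℕ.+ 0) k * ([ i ℕ.+ 0 , i ] * 1#) ∎
  chain-factor-ballot {m} {n} k i (suc d) ≡.refl ≡.refl with chain-factor-central-suc k i (suc d) ≡.refl ≡.refl
  ... | y , y-ratio , eq =
    modulo (chain-factor-central k i (suc d) ≡.refl ≡.refl) 1#
    (modulo eq (- Z)
    (modulo poch-s (b * x)
    (modulo central-ratio (Z * P * (x - y))
    (modulo y-ratio (- (Z * P * b))
    (modulo q^s (b * x * P * (q * q^ d - 1#))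
    (modulo (pow-+ q i (suc d)) (- (Z * b * x * P))
    (solve 15 (λ q C n₀ n₁ b b⁺ x y P P₀ Z S I J D →
       C :* (n₀ :- Z :* n₁)
       := (b :- Z :* b⁺) :* (x :* (P :* (:1 :- q :* S :* D)))
         :+ :1 :* (C :* n₀ :- b :* x :* P₀)
         :+ :- Z :* (C :* n₁ :- b⁺ :* y :* (P :* (:1 :- q :* S :* D)))
         :+ b :* x :* (P₀ :- (:1 :- S) :* P)
         :+ Z :* P :* (x :- y) :* ((:1 :- q :* S :* D) :* b⁺ :- (:1 :- J) :* b)
         :+ :- (Z :* P :* b) :* ((:1 :- J) :* y :- (:1 :- I) :* x)
         :+ b :* x :* P :* (q :* D :- :1) :* (S :- Z :* I)
         :+ :- (Z :* b :* x :* P) :* (J :- I :* (q :* D)))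
     refl q (chain-factor m n (suc d)) (central n k) (central n (suc k)) b (central m (suc k)) x y P (⟨ q^ s ⟩ suc d)
       Z (q^ s) (q^ i) (q^ (i ℕ.+ suc d)) (q^ d))))))))
    where
    s : ℕ
    s = suc (n ℕ.+ k)
    x P b Z : Carrier
    x = [ i ℕ.+ suc d , i ]
    P = ⟨ q^ suc s ⟩ d
    b = central m k
    Z = q^ suc (k ℕ.+ k)
    poch-s : ⟨ q^ s ⟩ suc d ≈ (1# - q^ s) * P
    poch-s = trans (poch-head (q^ s) d) (*-congˡ (poch-cong d (*-comm (q^ s) q)))
    q^s : q^ s ≈ Z * q^ i
    q^s = trans (q^-cong (ℕ-solve 2 (λ k i → ℕ-con 1 ⊕ (k ⊕ i ⊕ k) ⊜ ℕ-con 1 ⊕ (k ⊕ k) ⊕ i) ≡.refl k i)) (pow-+ q (suc (k ℕ.+ k)) i)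
    central-ratio : (1# - q * q^ s * q^ d) * central m (suc k) ≈ (1# - q^ (i ℕ.+ suc d)) * central m k
    central-ratio = begin
      (1# - q * q^ s * q^ d) * central m (suc k)
        ≈⟨ *-cong (+-congˡ (-‿cong (sym (trans (q^-cong suc[m+k]) (pow-+ q (suc s) d))))) (binom-congʳ (m ℕ.+ m) (ℕ.+-suc m k)) ⟩
      (1# - q^ suc (m ℕ.+ k)) * [ m ℕ.+ m , suc (m ℕ.+ k) ]
        ≈⟨ binom-ratio (m ℕ.+ k) (i ℕ.+ suc d) m+k+i+d ⟨
      (1# - q^ (i ℕ.+ suc d)) * central m k ∎
      where
      suc[m+k] : suc (m ℕ.+ k) ≡ suc s ℕ.+ d
      suc[m+k] = ℕ-solve 3 (λ n d k → ℕ-con 1 ⊕ (n ⊕ (ℕ-con 1 ⊕ d) ⊕ k) ⊜ ℕ-con 2 ⊕ (n ⊕ k) ⊕ d) ≡.refl n d k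
      m+k+i+d : m ℕ.+ k ℕ.+ (i ℕ.+ suc d) ≡ m ℕ.+ m
      m+k+i+d = ℕ-solve 3 (λ k i d → k ⊕ i ⊕ d ⊕ k ⊕ (i ⊕ d) ⊜ k ⊕ i ⊕ d ⊕ (k ⊕ i ⊕ d)) ≡.refl k i (suc d)

  q-Chu-Vandermonde-term : Carrier → ℕ → ℕ → Carrier
  q-Chu-Vandermonde-term a M i =
    pow R a i * q^ (i ℕ.* i) * [ M , i ] * ⟨ a * q^ suc i ⟩ (M ℕ.∸ i)

  q^-square : ∀ i → q^ (suc i ℕ.* suc i) ≈ q * (q^ (i ℕ.* i) * q^ i * q^ i)
  q^-square i = trans (q^-cong (ℕ-solve 1 (λ i → (ℕ-con 1 ⊕ i) ⊛ (ℕ-con 1 ⊕ i) ⊜ ℕ-con 1 ⊕ (i ⊛ i ⊕ i ⊕ i)) ≡.refl i))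
    (*-congˡ (trans (pow-+ q (i ℕ.* i ℕ.+ i) i) (*-congʳ (pow-+ q (i ℕ.* i) i))))

  -- A limiting case of the q-Chu-Vandermonde sum, multiplied by (aq)_M. The q-Pascal rule regroups
  -- the terms on [M,i]; there `u` cancels the second part of the first Pochhammer factor of `v`,
  -- and the same sum for M and aq remains. Hence the induction varies `a`.
  q-Chu-Vandermonde : ∀ M a → Σ< (suc M) (q-Chu-Vandermonde-term a M) ≈ 1#
  q-Chu-Vandermonde zero a = solve 0 (:0 :+ :1 :* :1 :* :1 :* :1 := :1) refl
  q-Chu-Vandermonde (suc M) a = begin
    Σ< (suc (suc M)) (q-Chu-Vandermonde-term a (suc M))
      ≈⟨ sum-head (suc M) _ ⟩
    q-Chu-Vandermonde-term a (suc M) 0 + Σ< (suc M) (λ i → q-Chu-Vandermonde-term a (suc M) (suc i))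
      ≈⟨ +-cong (*-congʳ (solve 0 (:1 :* :1 :* :1 := :1 :* :1 :* :1 :* :1) refl)) (trans (sum-cong (suc M) (λ i _ → pascal i)) (sum-+ (suc M) u (λ i → v (suc i)))) ⟩
    v 0 + (Σ< (suc M) u + Σ< (suc M) (λ i → v (suc i)))
      ≈⟨ solve 3 (λ x y z → x :+ (y :+ z) := y :+ (x :+ z)) refl _ _ _ ⟩
    Σ< (suc M) u + (v 0 + Σ< (suc M) (λ i → v (suc i)))
      ≈⟨ +-congˡ (sum-head (suc M) v) ⟨
    Σ< (suc M) u + (Σ< (suc M) v + v (suc M))
      ≈⟨ +-congˡ (trans (+-congˡ v-last) (+-identityʳ _)) ⟩
    Σ< (suc M) u + Σ< (suc M) v
      ≈⟨ sum-+ (suc M) u v ⟨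
    Σ< (suc M) (λ i → u i + v i)
      ≈⟨ sum-cong (suc M) (λ i i≤M → shift i (ℕ.≤-pred i≤M)) ⟩
    Σ< (suc M) (q-Chu-Vandermonde-term (a * q) M)
      ≈⟨ q-Chu-Vandermonde M (a * q) ⟩
    1# ∎
    where
    u v : ℕ → Carrier
    u i = pow R a (suc i) * q^ (suc i ℕ.* suc i) * [ M , i ] * ⟨ a * q^ suc (suc i) ⟩ (M ℕ.∸ i)
    v i = pow R a i * q^ (i ℕ.* i) * q^ i * [ M , i ] * ⟨ a * q^ suc i ⟩ (suc M ℕ.∸ i)
    pascal : ∀ i → q-Chu-Vandermonde-term a (suc M) (suc i) ≈ u i + v (suc i)
    pascal i = solve 6 (λ A B C X Y P → A :* B :* (X :+ C :* Y) :* P := A :* B :* X :* P :+ A :* B :* C :* Y :* P)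
      refl _ _ _ _ _ _
    v-last : v (suc M) ≈ 0#
    v-last = trans (*-congʳ (trans (*-congˡ (binom-zero (ℕ.n<1+n M))) (zeroʳ _))) (zeroˡ _)
    shift : ∀ i → i ≤ M → u i + v i ≈ q-Chu-Vandermonde-term (a * q) M i
    shift i i≤M =
      modulo (q^-square i) (pow R a (suc i) * X * P)
      (modulo (trans (reflexive (≡.cong ⟨ a * q^ suc i ⟩_ (ℕ.+-∸-assoc 1 i≤M))) (poch-head (a * q^ suc i) (M ℕ.∸ i)))
              (pow R a i * q^ (i ℕ.* i) * q^ i * X)
      (modulo (poch-cong (M ℕ.∸ i) (solve 3 (λ a q I → a :* (q :* I) :* q := a :* (q :* (q :* I))) refl a q (q^ i)))
              (pow R a i * q^ (i ℕ.* i) * q^ i * X * (1# - a * q^ suc i))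
      (modulo (poch-cong (M ℕ.∸ i) (solve 3 (λ a q I → a :* (q :* (q :* I)) := a :* q :* (q :* I)) refl a q (q^ i)))
              (pow R a i * q^ i * q^ (i ℕ.* i) * X)
      (modulo (pow-* a q i) (- (q^ (i ℕ.* i) * X * P′))
      (solve 12 (λ a q A I II J AQ X P P₁ P₂ P₃ →
         a :* A :* J :* X :* P :+ A :* II :* I :* X :* P₁
         := AQ :* II :* X :* P₃
           :+ a :* A :* X :* P :* (J :- q :* (II :* I :* I))
           :+ A :* II :* I :* X :* (P₁ :- (:1 :- a :* (q :* I)) :* P₂)
           :+ A :* II :* I :* X :* (:1 :- a :* (q :* I)) :* (P₂ :- P)
           :+ A :* I :* II :* X :* (P :- P₃)
           :+ :- (II :* X :* P₃) :* (AQ :- A :* I))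
        refl a q (pow R a i) (q^ i) (q^ (i ℕ.* i)) (q^ (suc i ℕ.* suc i)) (pow R (a * q) i) X P
          (⟨ a * q^ suc i ⟩ (suc M ℕ.∸ i)) (⟨ a * q^ suc i * q ⟩ (M ℕ.∸ i)) P′)))))
      where
      X P P′ : Carrier
      X = [ M , i ]
      P = ⟨ a * q^ suc (suc i) ⟩ (M ℕ.∸ i)
      P′ = ⟨ a * q * q^ suc i ⟩ (M ℕ.∸ i)

  -- For fixed k, n ↦ `ballot n k` is an eigenvector of the chain kernel with eigenvalue q^(k(k+1)).
  -- Terms with n < k vanish; for n = k + i, `chain-factor-ballot` leaves the q-Chu-Vandermonde sum
  -- at a = q^(2k+1).
  bailey-lemma : ∀ k m →
    Σ< (suc m) (λ n → q^ (n ℕ.* suc n) * chain-factor m n (m ℕ.∸ n) * ballot n k) ≈ q^ (k ℕ.* suc k) * ballot m k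
  bailey-lemma k m with k ℕ.≤? m
  ... | no k≰m = begin
    Σ< (suc m) (λ n → q^ (n ℕ.* suc n) * chain-factor m n (m ℕ.∸ n) * ballot n k)
      ≈⟨ sum-zero (suc m) (λ n n≤m → trans (*-congˡ (ballot-zero (ℕ.<-≤-trans n≤m m<k))) (zeroʳ _)) ⟩
    0#
      ≈⟨ trans (*-congˡ (ballot-zero m<k)) (zeroʳ _) ⟨
    q^ (k ℕ.* suc k) * ballot m k ∎
    where
    m<k : m < k
    m<k = ℕ.≰⇒> k≰m
  ... | yes k≤m = begin
    Σ< (suc m) f
      ≈⟨ reflexive (≡.cong (λ x → Σ< x f) (≡.trans (ℕ.+-suc k M) (≡.cong suc k+M≡m))) ⟨
    Σ< (k ℕ.+ suc M) f
      ≈⟨ sum-split k (suc M) f ⟩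
    Σ< k f + Σ< (suc M) (λ i → f (k ℕ.+ i))
      ≈⟨ +-cong (sum-zero k (λ n n<k → trans (*-congˡ (ballot-zero n<k)) (zeroʳ _))) (sum-cong (suc M) (λ i i≤M → term i (ℕ.≤-pred i≤M))) ⟩
    0# + Σ< (suc M) (λ i → q^ (k ℕ.* suc k) * ballot m k * q-Chu-Vandermonde-term a M i)
      ≈⟨ trans (+-identityˡ _) (sym (sum-*ˡ (suc M) _ _)) ⟩
    q^ (k ℕ.* suc k) * ballot m k * Σ< (suc M) (q-Chu-Vandermonde-term a M)
      ≈⟨ trans (*-congˡ (q-Chu-Vandermonde M a)) (*-identityʳ _) ⟩
    q^ (k ℕ.* suc k) * ballot m k ∎
    where
    M : ℕ
    M = m ℕ.∸ k
    a : Carrier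
    a = q^ suc (k ℕ.+ k)
    f : ℕ → Carrier
    f n = q^ (n ℕ.* suc n) * chain-factor m n (m ℕ.∸ n) * ballot n k
    k+M≡m : k ℕ.+ M ≡ m
    k+M≡m = ℕ.m+[n∸m]≡n k≤m
    term : ∀ i → i ≤ M → f (k ℕ.+ i) ≈ q^ (k ℕ.* suc k) * ballot m k * q-Chu-Vandermonde-term a M i
    term i i≤M = begin
      q^ (n ℕ.* suc n) * chain-factor m n (m ℕ.∸ n) * ballot n k
        ≈⟨ *-assoc _ _ _ ⟩
      q^ (n ℕ.* suc n) * (chain-factor m n (m ℕ.∸ n) * ballot n k)
        ≈⟨ *-congˡ (*-congʳ (reflexive (≡.cong (chain-factor m n) (≡.sym (ℕ.∸-+-assoc m k i))))) ⟩
      q^ (n ℕ.* suc n) * (chain-factor m n d * ballot n k)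
        ≈⟨ *-cong exponent (chain-factor-ballot k i d ≡.refl n+d≡m) ⟩
      q^ (k ℕ.* suc k) * (pow R a i * q^ (i ℕ.* i)) * (ballot m k * ([ i ℕ.+ d , i ] * ⟨ q^ suc (suc (n ℕ.+ k)) ⟩ d))
        ≈⟨ *-congˡ (*-congˡ (*-cong (binom-congˡ i (ℕ.m+[n∸m]≡n i≤M)) (poch-cong d base))) ⟩
      q^ (k ℕ.* suc k) * (pow R a i * q^ (i ℕ.* i)) * (ballot m k * ([ M , i ] * ⟨ a * q^ suc i ⟩ d))
        ≈⟨ solve 6 (λ u v w x y z → u :* (v :* w) :* (x :* (y :* z)) := u :* x :* (v :* w :* y :* z)) refl _ _ _ _ _ _ ⟩
      q^ (k ℕ.* suc k) * ballot m k * q-Chu-Vandermonde-term a M i ∎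
      where
      n d : ℕ
      n = k ℕ.+ i
      d = M ℕ.∸ i
      n+d≡m : n ℕ.+ d ≡ m
      n+d≡m = ≡.trans (ℕ.+-assoc k i d) (≡.trans (≡.cong (k ℕ.+_) (ℕ.m+[n∸m]≡n i≤M)) k+M≡m)
      exponent : q^ (n ℕ.* suc n) ≈ q^ (k ℕ.* suc k) * (pow R a i * q^ (i ℕ.* i))
      exponent = begin
        q^ (n ℕ.* suc n)
          ≈⟨ q^-cong (ℕ-solve 2 (λ k i → (k ⊕ i) ⊛ (ℕ-con 1 ⊕ (k ⊕ i)) ⊜ k ⊛ (ℕ-con 1 ⊕ k) ⊕ (i ⊛ (ℕ-con 1 ⊕ (k ⊕ k)) ⊕ i ⊛ i)) ≡.refl k i) ⟩
        q^ (k ℕ.* suc k ℕ.+ (i ℕ.* suc (k ℕ.+ k) ℕ.+ i ℕ.* i))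
          ≈⟨ trans (pow-+ q (k ℕ.* suc k) _) (*-congˡ (pow-+ q (i ℕ.* suc (k ℕ.+ k)) (i ℕ.* i))) ⟩
        q^ (k ℕ.* suc k) * (q^ (i ℕ.* suc (k ℕ.+ k)) * q^ (i ℕ.* i))
          ≈⟨ *-congˡ (*-congʳ (pow-pow q (suc (k ℕ.+ k)) i)) ⟨
        q^ (k ℕ.* suc k) * (pow R a i * q^ (i ℕ.* i)) ∎
      base : q^ suc (suc (n ℕ.+ k)) ≈ a * q^ suc i
      base = trans (q^-cong (ℕ-solve 2 (λ k i → ℕ-con 2 ⊕ (k ⊕ i ⊕ k) ⊜ ℕ-con 1 ⊕ (k ⊕ k) ⊕ (ℕ-con 1 ⊕ i)) ≡.refl k i))
                   (pow-+ q (suc (k ℕ.+ k)) (suc i))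

  -- Since `ballot n k` vanishes for k > n, one bound K above m serves all n ≤ m, and a range
  -- independent of n lets the two sums be exchanged.
  bailey-step : ∀ {K} (A w : ℕ → Carrier) →
    (∀ n → n < K → A n ≈ Σ< K (λ k → w k * ballot n k)) →
    ∀ m → m < K →
    Σ< (suc m) (λ n → q^ (n ℕ.* suc n) * chain-factor m n (m ℕ.∸ n) * A n)
      ≈ Σ< K (λ k → w k * q^ (k ℕ.* suc k) * ballot m k)
  bailey-step {K} A w A≈ m m<K = begin
    Σ< (suc m) (λ n → κ n * A n)
      ≈⟨ sum-cong (suc m) (λ n n≤m → trans (*-congˡ (A≈ n (ℕ.<-≤-trans n≤m m<K))) (sum-*ˡ K _ _)) ⟩
    Σ< (suc m) (λ n → Σ< K (λ k → κ n * (w k * ballot n k)))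
      ≈⟨ sum-swap (suc m) K _ ⟩
    Σ< K (λ k → Σ< (suc m) (λ n → κ n * (w k * ballot n k)))
      ≈⟨ sum-cong K (λ k _ → trans (sum-cong (suc m) (λ n _ → solve 3 (λ x y z → x :* (y :* z) := y :* (x :* z)) refl _ _ _)) (sym (sum-*ˡ (suc m) _ _))) ⟩
    Σ< K (λ k → w k * Σ< (suc m) (λ n → κ n * ballot n k))
      ≈⟨ sum-cong K (λ k _ → trans (*-congˡ (bailey-lemma k m)) (sym (*-assoc _ _ _))) ⟩
    Σ< K (λ k → w k * q^ (k ℕ.* suc k) * ballot m k) ∎
    where
    κ : ℕ → Carrier
    κ n = q^ (n ℕ.* suc n) * chain-factor m n (m ℕ.∸ n)

  -- (−1)^k q^(k(k−1)/2)
  unit-weight : ℕ → Carrier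
  unit-weight zero    = 1#
  unit-weight (suc k) = - (q^ k * unit-weight k)

  kronecker₀ : ℕ → Carrier
  kronecker₀ zero    = 1#
  kronecker₀ (suc n) = 0#

  unit-pair : ∀ {K} n → n < K → kronecker₀ n ≈ Σ< K (λ k → unit-weight k * ballot n k)
  unit-pair {suc K} zero _ = sym (begin
    Σ< (suc K) (λ k → unit-weight k * ballot 0 k)
      ≈⟨ sum-head K _ ⟩
    1# * (1# - q^ 1 * 0#) + Σ< K (λ k → unit-weight (suc k) * ballot 0 (suc k))
      ≈⟨ +-cong (solve 1 (λ x → :1 :* (:1 :- x :* :0) := :1) refl _)
                (sum-zero K (λ k _ → trans (*-congˡ (ballot-zero {0} {suc k} (s≤s z≤n))) (zeroʳ _))) ⟩
    1# + 0#
      ≈⟨ +-identityʳ 1# ⟩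
    1# ∎)
  unit-pair {K} (suc n) n<K = sym (begin
    Σ< K (λ k → unit-weight k * ballot (suc n) k)
      ≈⟨ sum-cong K (λ k _ → term k) ⟩
    Σ< K (λ k → G k - G (suc k))
      ≈⟨ sum-telescope K G ⟩
    G 0 - G K
      ≈⟨ +-cong G-first (-‿cong G-last) ⟩
    0# - 0#
      ≈⟨ -‿inverseʳ 0# ⟩
    0# ∎)
    where
    N : ℕ
    N = n ℕ.+ suc n
    -- The antidifference comes from lowering `ballot (suc n) k` to row 2n + 1 by the q-Pascal rule.
    -- It vanishes at 0 by the symmetry of that odd row, and at K because n + K lies beyond the row.
    G : ℕ → Carrier
    G k = unit-weight k * ([ N , n ℕ.+ k ] - q^ k * [ N , suc (n ℕ.+ k) ])
    G-first : G 0 ≈ 0#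
    G-first = begin
      1# * ([ N , n ℕ.+ 0 ] - 1# * [ N , suc (n ℕ.+ 0) ])
        ≈⟨ *-congˡ (+-congʳ (binom-sym (n ℕ.+ 0) (suc (n ℕ.+ 0)) (≡.cong₂ (λ x y → x ℕ.+ suc y) (ℕ.+-identityʳ n) (ℕ.+-identityʳ n)))) ⟩
      1# * ([ N , suc (n ℕ.+ 0) ] - 1# * [ N , suc (n ℕ.+ 0) ])
        ≈⟨ solve 1 (λ x → :1 :* (x :- :1 :* x) := :0) refl _ ⟩
      0# ∎
    G-last : G K ≈ 0#
    G-last = begin
      unit-weight K * ([ N , n ℕ.+ K ] - q^ K * [ N , suc (n ℕ.+ K) ])
        ≈⟨ *-congˡ (+-cong (binom-zero N<n+K) (-‿cong (*-congˡ (binom-zero (ℕ.m<n⇒m<1+n N<n+K))))) ⟩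
      unit-weight K * (0# - q^ K * 0#)
        ≈⟨ solve 2 (λ x y → x :* (:0 :- y :* :0) := :0) refl _ _ ⟩
      0# ∎
      where
      N<n+K : N < n ℕ.+ K
      N<n+K = ℕ.+-monoʳ-< n n<K
    term : ∀ k → unit-weight k * ballot (suc n) k ≈ G k - G (suc k)
    term k =
      modulo (binom-congʳ (suc N) {suc n ℕ.+ suc k} {suc (suc (n ℕ.+ k))} (≡.cong suc (ℕ.+-suc n k))) (- (w * Z))
      (modulo (binom-congʳ N {n ℕ.+ suc k} {suc (n ℕ.+ k)} (ℕ.+-suc n k)) (- (w * q^ k))
      (modulo (binom-congʳ N {suc (n ℕ.+ suc k)} {suc (suc (n ℕ.+ k))} (≡.cong suc (ℕ.+-suc n k))) (w * q^ k * q^ suc k)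
      (modulo (pow-+ q (suc k) k) (- (w * (y + q * (q * (q^ (n ℕ.+ k))) * z)))
      (modulo (pow-+ q n k) (w * q * y)
      (modulo (binom-ratio-shifted N (suc (n ℕ.+ k)) k n eq) (- (w * q^ suc k))
      (solve 12 (λ q w K A A+K x y z y′ z′ t Z →
         w :* ((x :+ q :* A+K :* y) :- Z :* t)
         := (w :* (x :- K :* y) :- :- (K :* w) :* (y′ :- q :* K :* z′))
           :+ :- (w :* Z) :* (t :- (y :+ q :* (q :* A+K) :* z))
           :+ :- (w :* K) :* (y′ :- y)
           :+ w :* K :* (q :* K) :* (z′ :- z)
           :+ :- (w :* (y :+ q :* (q :* A+K) :* z)) :* (Z :- q :* K :* K)
           :+ w :* q :* y :* (A+K :- A :* K)
           :+ :- (w :* (q :* K)) :* ((K :- A) :* y :- K :* (:1 :- q :* (q :* A+K)) :* z))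
       refl q w (q^ k) (q^ n) (q^ (n ℕ.+ k)) x y z [ N , n ℕ.+ suc k ] [ N , suc (n ℕ.+ suc k) ]
         [ suc N , suc n ℕ.+ suc k ] Z))))))
      where
      w x y z Z : Carrier
      w = unit-weight k
      x = [ N , n ℕ.+ k ]
      y = [ N , suc (n ℕ.+ k) ]
      z = [ N , suc (suc (n ℕ.+ k)) ]
      Z = q^ suc (k ℕ.+ k)
      eq : n ℕ.+ suc (n ℕ.+ k) ≡ k ℕ.+ N
      eq = ℕ-solve 2 (λ n k → n ⊕ (ℕ-con 1 ⊕ (n ⊕ k)) ⊜ k ⊕ (n ⊕ (ℕ-con 1 ⊕ n))) ≡.refl n k

  -- With the Pochhammer factor in front, `chain-factor-spec` converts one link of `inner` into the
  -- chain kernel, and each link multiplies the k-th weight by q^(k(k+1)). The case j = 0 is already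
  -- one application, to the unit pair, where only n = 0 survives.
  inner-expansion : ∀ {K} j m → m < K →
    ⟨ q^ suc m ⟩ m * inner R q j m
      ≈ Σ< K (λ k → unit-weight k * pow R (q^ (k ℕ.* suc k)) (suc j) * ballot m k)
  inner-expansion {K} zero m m<K = begin
    ⟨ q^ suc m ⟩ m * 1#
      ≈⟨ solve 1 (λ x → x :* :1 := :1 :* (:1 :* x) :* :1 :+ :0) refl _ ⟩
    1# * chain-factor m 0 m * 1# + 0#
      ≈⟨ +-congˡ (sum-zero m (λ n _ → zeroʳ _)) ⟨
    1# * chain-factor m 0 m * 1# + Σ< m (λ n → q^ (suc n ℕ.* suc (suc n)) * chain-factor m (suc n) (m ℕ.∸ suc n) * 0#)
      ≈⟨ sum-head m _ ⟨
    Σ< (suc m) (λ n → q^ (n ℕ.* suc n) * chain-factor m n (m ℕ.∸ n) * kronecker₀ n)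
      ≈⟨ bailey-step kronecker₀ unit-weight unit-pair m m<K ⟩
    Σ< K (λ k → unit-weight k * q^ (k ℕ.* suc k) * ballot m k)
      ≈⟨ sum-cong K (λ k _ → *-congʳ (*-congˡ (sym (*-identityʳ _)))) ⟩
    Σ< K (λ k → unit-weight k * (q^ (k ℕ.* suc k) * 1#) * ballot m k) ∎
  inner-expansion {K} (suc j) m m<K = begin
    ⟨ q^ suc m ⟩ m * Σ< (suc m) (λ n → q^ (n ℕ.* suc n) * [ m , n ] * inner R q j n)
      ≈⟨ sum-*ˡ (suc m) _ _ ⟩
    Σ< (suc m) (λ n → ⟨ q^ suc m ⟩ m * (q^ (n ℕ.* suc n) * [ m , n ] * inner R q j n))
      ≈⟨ sum-cong (suc m) (λ n n≤m → rearrange n (ℕ.≤-pred n≤m)) ⟩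
    Σ< (suc m) (λ n → q^ (n ℕ.* suc n) * chain-factor m n (m ℕ.∸ n) * (⟨ q^ suc n ⟩ n * inner R q j n))
      ≈⟨ bailey-step (λ n → ⟨ q^ suc n ⟩ n * inner R q j n) _ (inner-expansion j) m m<K ⟩
    Σ< K (λ k → unit-weight k * pow R (q^ (k ℕ.* suc k)) (suc j) * q^ (k ℕ.* suc k) * ballot m k)
      ≈⟨ sum-cong K (λ k _ → *-congʳ (solve 3 (λ x y z → x :* y :* z := x :* (z :* y)) refl _ _ _)) ⟩
    Σ< K (λ k → unit-weight k * pow R (q^ (k ℕ.* suc k)) (suc (suc j)) * ballot m k) ∎
    where
    rearrange : ∀ n → n ≤ m →
      ⟨ q^ suc m ⟩ m * (q^ (n ℕ.* suc n) * [ m , n ] * inner R q j n)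
        ≈ q^ (n ℕ.* suc n) * chain-factor m n (m ℕ.∸ n) * (⟨ q^ suc n ⟩ n * inner R q j n)
    rearrange n n≤m = modulo (chain-factor-spec n (m ℕ.∸ n) (ℕ.m+[n∸m]≡n n≤m)) (q^ (n ℕ.* suc n) * inner R q j n)
      (solve 6 (λ P e B I C Q → P :* (e :* B :* I) := e :* C :* (Q :* I) :+ e :* I :* (B :* P :- Q :* C))
        refl _ _ _ _ _ _)

-- The values of the central sums and their relation to α.

module PentagonalSequence {c ℓ : Level} (R : CommutativeRing c ℓ) (q : CommutativeRing.Carrier R) where
  open CommutativeRing R hiding (zero)
  open DifferenceSolver R
  open GaussianBinomials R q
  open SetoidReasoning setoid
  open ℕ-Solver.+-*-Solver using () renaming (solve to ℕ-solve; _:+_ to _⊕_; _:*_ to _⊛_; _:=_ to _⊜_; con to ℕ-con)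

  -- At a primitive N-th root of unity, v i = q^(i²−i+1) ∑_{m<N} q^m [2m, m+N−i].
  v : ℕ → Carrier
  v 0 = 0#
  v 1 = 1#
  v 2 = - 1#
  v (suc (suc (suc i))) = q^ (i ℕ.+ i) * v i

  -- 3r² − r, without truncated subtraction
  pentagonal : ℕ → ℕ
  pentagonal zero    = 0
  pentagonal (suc r) = (1 ℕ.+ r ℕ.* 3) ℕ.+ (1 ℕ.+ r ℕ.* 3) ℕ.+ pentagonal r

  pentagonal-closed : ∀ r → 3 ℕ.* r ℕ.* r ≡ r ℕ.+ pentagonal r
  pentagonal-closed zero    = ≡.refl
  pentagonal-closed (suc r) = ≡.trans
    (ℕ-solve 1 (λ r → ℕ-con 3 ⊛ (ℕ-con 1 ⊕ r) ⊛ (ℕ-con 1 ⊕ r) ⊜ ℕ-con 3 ⊛ r ⊛ r ⊕ (ℕ-con 6 ⊛ r ⊕ ℕ-con 3)) ≡.refl r)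
    (≡.trans (≡.cong (ℕ._+ (6 ℕ.* r ℕ.+ 3)) (pentagonal-closed r))
    (ℕ-solve 2 (λ r e → r ⊕ e ⊕ (ℕ-con 6 ⊛ r ⊕ ℕ-con 3) ⊜ ℕ-con 1 ⊕ r ⊕ (ℕ-con 1 ⊕ r ⊛ ℕ-con 3 ⊕ (ℕ-con 1 ⊕ r ⊛ ℕ-con 3) ⊕ e)) ≡.refl r (pentagonal r)))

  v-0 : ∀ r → v (r ℕ.* 3) ≈ 0#
  v-0 zero    = refl
  v-0 (suc r) = trans (*-congˡ (v-0 r)) (zeroʳ _)

  -- The increment 2(3r + 1) of `pentagonal` is the exponent in the recursion of `v`.
  v-1 : ∀ r → v (1 ℕ.+ r ℕ.* 3) ≈ q^ pentagonal r
  v-1 zero    = refl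
  v-1 (suc r) = trans (*-congˡ (v-1 r)) (sym (pow-+ q (1 ℕ.+ r ℕ.* 3 ℕ.+ (1 ℕ.+ r ℕ.* 3)) (pentagonal r)))

  v-2 : ∀ r → v (2 ℕ.+ r ℕ.* 3) ≈ - (q^ (3 ℕ.* r ℕ.* r ℕ.+ r))
  v-2 zero    = refl
  v-2 (suc r) = begin
    q^ (i ℕ.+ i) * v i                              ≈⟨ *-congˡ (v-2 r) ⟩
    q^ (i ℕ.+ i) * - (q^ (3 ℕ.* r ℕ.* r ℕ.+ r))     ≈⟨ solve 2 (λ x y → x :* :- y := :- (x :* y)) refl _ _ ⟩
    - (q^ (i ℕ.+ i) * q^ (3 ℕ.* r ℕ.* r ℕ.+ r))     ≈⟨ -‿cong (pow-+ q (i ℕ.+ i) _) ⟨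
    - (q^ (i ℕ.+ i ℕ.+ (3 ℕ.* r ℕ.* r ℕ.+ r)))      ≈⟨ -‿cong (q^-cong (exponent r)) ⟩
    - (q^ (3 ℕ.* suc r ℕ.* suc r ℕ.+ suc r))        ∎
    where
    i : ℕ
    i = 2 ℕ.+ r ℕ.* 3
    exponent : ∀ r → (2 ℕ.+ r ℕ.* 3) ℕ.+ (2 ℕ.+ r ℕ.* 3) ℕ.+ (3 ℕ.* r ℕ.* r ℕ.+ r) ≡ 3 ℕ.* suc r ℕ.* suc r ℕ.+ suc r
    exponent = ℕ-solve 1 (λ r → ℕ-con 2 ⊕ r ⊛ ℕ-con 3 ⊕ (ℕ-con 2 ⊕ r ⊛ ℕ-con 3) ⊕ (ℕ-con 3 ⊛ r ⊛ r ⊕ r)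
      ⊜ ℕ-con 3 ⊛ (ℕ-con 1 ⊕ r) ⊛ (ℕ-con 1 ⊕ r) ⊕ (ℕ-con 1 ⊕ r)) ≡.refl

  -- `alpha` branches on a residue and reduces only once this residue is abstracted together with
  -- its equation.
  alpha-0 : ∀ k → k ℕ.% 3 ≡ 0 → alpha R q k ≡ q^ (3 ℕ.* (k ℕ./ 3) ℕ.* (k ℕ./ 3) ℕ.∸ k ℕ./ 3)
  alpha-0 k eq with k ℕ.% 3 | eq
  ... | .0 | ≡.refl = ≡.refl

  alpha-1 : ∀ k → k ℕ.% 3 ≡ 1 → alpha R q k ≡
    - (q^ (3 ℕ.* (k ℕ./ 3) ℕ.* (k ℕ./ 3) ℕ.+ k ℕ./ 3) + q^ (3 ℕ.* (k ℕ./ 3) ℕ.* (k ℕ./ 3) ℕ.+ 5 ℕ.* (k ℕ./ 3) ℕ.+ 2))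
  alpha-1 k eq with k ℕ.% 3 | eq
  ... | .1 | ≡.refl = ≡.refl

  alpha-2 : ∀ k → k ℕ.% 3 ≡ 2 → alpha R q k ≡ q^ (3 ℕ.* suc (k ℕ./ 3) ℕ.* suc (k ℕ./ 3) ℕ.+ suc (k ℕ./ 3))
  alpha-2 k eq with k ℕ.% 3 | eq
  ... | .2 | ≡.refl = ≡.refl

  -- `v` vanishes at multiples of 3, so the first term drops out for i ≡ 2 and the second for i ≡ 0
  -- modulo 3; only i ≡ 1 keeps both, as in the definition of α.
  alpha-v : ∀ i → alpha R q i ≈ v (suc i) - q^ (i ℕ.+ i) * v i
  alpha-v i = by-residue (i ℕ.% 3) ≡.refl (ℕ.m%n<n i 3) (ℕ.m≡m%n+[m/n]*n i 3)
    where
    r : ℕ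
    r = i ℕ./ 3
    Difference : ℕ → Carrier
    Difference n = v (suc n) - q^ (n ℕ.+ n) * v n
    by-residue : ∀ t → i ℕ.% 3 ≡ t → i ℕ.% 3 < 3 → i ≡ i ℕ.% 3 ℕ.+ r ℕ.* 3 → alpha R q i ≈ Difference i
    by-residue 0 eq _ i≡ = begin
      alpha R q i
        ≈⟨ reflexive (alpha-0 i eq) ⟩
      q^ (3 ℕ.* r ℕ.* r ℕ.∸ r)
        ≈⟨ q^-cong (≡.trans (≡.cong (ℕ._∸ r) (pentagonal-closed r)) (ℕ.m+n∸m≡n r (pentagonal r))) ⟩
      q^ pentagonal r
        ≈⟨ solve 2 (λ x y → x := x :- y :* :0) refl _ _ ⟩
      q^ pentagonal r - q^ (r ℕ.* 3 ℕ.+ r ℕ.* 3) * 0#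
        ≈⟨ +-cong (v-1 r) (-‿cong (*-congˡ (v-0 r))) ⟨
      Difference (r ℕ.* 3)
        ≈⟨ reflexive (≡.cong Difference (≡.trans i≡ (≡.cong (ℕ._+ r ℕ.* 3) eq))) ⟨
      Difference i ∎
    by-residue 1 eq _ i≡ = begin
      alpha R q i
        ≈⟨ reflexive (alpha-1 i eq) ⟩
      - (q^ (3 ℕ.* r ℕ.* r ℕ.+ r) + q^ (3 ℕ.* r ℕ.* r ℕ.+ 5 ℕ.* r ℕ.+ 2))
        ≈⟨ -‿cong (+-congˡ (trans (q^-cong exponent) (pow-+ q (n ℕ.+ n) (pentagonal r)))) ⟩
      - (q^ (3 ℕ.* r ℕ.* r ℕ.+ r) + q^ (n ℕ.+ n) * q^ pentagonal r)
        ≈⟨ solve 3 (λ x y z → :- (x :+ y :* z) := :- x :- y :* z) refl _ _ _ ⟩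
      - (q^ (3 ℕ.* r ℕ.* r ℕ.+ r)) - q^ (n ℕ.+ n) * q^ pentagonal r
        ≈⟨ +-cong (v-2 r) (-‿cong (*-congˡ (v-1 r))) ⟨
      Difference n
        ≈⟨ reflexive (≡.cong Difference (≡.trans i≡ (≡.cong (ℕ._+ r ℕ.* 3) eq))) ⟨
      Difference i ∎
      where
      n : ℕ
      n = 1 ℕ.+ r ℕ.* 3
      exponent : 3 ℕ.* r ℕ.* r ℕ.+ 5 ℕ.* r ℕ.+ 2 ≡ n ℕ.+ n ℕ.+ pentagonal r
      exponent = ≡.trans (≡.cong (λ x → x ℕ.+ 5 ℕ.* r ℕ.+ 2) (pentagonal-closed r))
        (ℕ-solve 2 (λ r e → r ⊕ e ⊕ ℕ-con 5 ⊛ r ⊕ ℕ-con 2 ⊜ ℕ-con 1 ⊕ r ⊛ ℕ-con 3 ⊕ (ℕ-con 1 ⊕ r ⊛ ℕ-con 3) ⊕ e) ≡.refl r (pentagonal r))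
    by-residue 2 eq _ i≡ = begin
      alpha R q i
        ≈⟨ reflexive (alpha-2 i eq) ⟩
      q^ (3 ℕ.* suc r ℕ.* suc r ℕ.+ suc r)
        ≈⟨ solve 1 (λ x → x := :0 :- :- x) refl _ ⟩
      0# - - (q^ (3 ℕ.* suc r ℕ.* suc r ℕ.+ suc r))
        -- Here `q^ (n + n) * v n` is `v (3 + n)` by definition, hence `v-2` at r + 1, in agreement
        -- with i = 3(r + 1) - 1.
        ≈⟨ +-cong (v-0 (suc r)) (-‿cong (v-2 (suc r))) ⟨
      Difference (2 ℕ.+ r ℕ.* 3)
        ≈⟨ reflexive (≡.cong Difference (≡.trans i≡ (≡.cong (ℕ._+ r ℕ.* 3) eq))) ⟨
      Difference i ∎
    by-residue (suc (suc (suc _))) eq i%3<3 _ = contradiction (≡.subst (_< 3) eq i%3<3) λ { (s≤s (s≤s (s≤s ()))) }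

-- Telescoping of sums of central binomials.

module CentralSums {c ℓ : Level} (R : CommutativeRing c ℓ) (q : CommutativeRing.Carrier R) where
  open CommutativeRing R hiding (zero)
  open DifferenceSolver R
  open GaussianBinomials R q
  open Sums R
  open BaileyChain R q
  open SetoidReasoning setoid
  open ℕ-Solver.+-*-Solver using () renaming (solve to ℕ-solve; _:+_ to _⊕_; _:*_ to _⊛_; _:=_ to _⊜_; con to ℕ-con)

  -- With q^k - q^m in place of 1 - q^(m-k) the relation also holds for k > m.
  central-ratio : ∀ m k →
    (q^ k - q^ m) * central m k ≈ q^ k * (1# - q * q^ m * q^ k) * central m (suc k)
  central-ratio m k = trans (binom-ratio-shifted (m ℕ.+ m) (m ℕ.+ k) k m eq)
    (*-cong (*-congˡ (+-congˡ (-‿cong (trans (*-congˡ (pow-+ q m k)) (sym (*-assoc _ _ _))))))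
            (binom-congʳ (m ℕ.+ m) (≡.sym (ℕ.+-suc m k))))
    where
    eq : m ℕ.+ (m ℕ.+ k) ≡ k ℕ.+ (m ℕ.+ m)
    eq = ℕ-solve 2 (λ m k → m ⊕ (m ⊕ k) ⊜ k ⊕ (m ⊕ m)) ≡.refl m k

  central-pascal : ∀ m k → central (suc m) (suc k) ≈
    central m k + q^ m * q^ suc k * (1# + q) * central m (suc k)
      + q * q * q^ m * q^ m * q^ suc k * q^ suc k * central m (suc (suc k))
  central-pascal m k =
    modulo (binom-congˡ (suc m ℕ.+ suc k) (≡.cong suc (ℕ.+-suc m m))) 1#
    (modulo (binom-congʳ (suc (suc (m ℕ.+ m))) {suc m ℕ.+ suc k} {suc (suc (m ℕ.+ k))} (≡.cong suc (ℕ.+-suc m k))) 1#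
    (modulo (binom-congʳ (m ℕ.+ m) {m ℕ.+ suc k} {suc (m ℕ.+ k)} (ℕ.+-suc m k)) (- (q^ m * q^ suc k * (1# + q)))
    (modulo (binom-congʳ (m ℕ.+ m) {m ℕ.+ suc (suc k)} {suc (suc (m ℕ.+ k))} (≡.trans (ℕ.+-suc m (suc k)) (≡.cong suc (ℕ.+-suc m k))))
      (- (q * q * q^ m * q^ m * q^ suc k * q^ suc k))
    (modulo (pow-+ q m k) (q * y + q * q * y + q * q * q * q * (q^ (m ℕ.+ k) + q^ m * q^ k) * z)
    (solve 11 (λ q Q K QK x y z y′ z′ c′ c″ →
       c′ := (x :+ Q :* (q :* K) :* (:1 :+ q) :* y′ :+ q :* q :* Q :* Q :* (q :* K) :* (q :* K) :* z′)
         :+ :1 :* (c′ :- c″)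
         :+ :1 :* (c″ :- (x :+ q :* QK :* y :+ q :* (q :* QK) :* (y :+ q :* (q :* QK) :* z)))
         :+ :- (Q :* (q :* K) :* (:1 :+ q)) :* (y′ :- y)
         :+ :- (q :* q :* Q :* Q :* (q :* K) :* (q :* K)) :* (z′ :- z)
         :+ (q :* y :+ q :* q :* y :+ q :* q :* q :* q :* (QK :+ Q :* K) :* z) :* (QK :- Q :* K))
      refl q (q^ m) (q^ k) (q^ (m ℕ.+ k)) (central m k) y z (central m (suc k)) (central m (suc (suc k)))
        (central (suc m) (suc k)) [ suc (suc (m ℕ.+ m)) , suc m ℕ.+ suc k ])))))
    where
    y z : Carrier
    y = [ m ℕ.+ m , suc (m ℕ.+ k) ]
    z = [ m ℕ.+ m , suc (suc (m ℕ.+ k)) ]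

  -- The certificate of a creative telescoping: the increments in m of `boundary (suc k)` involve
  -- only b(m,k) and b(m,k+3), with coefficients in which m occurs just as q^m.
  boundary : ℕ → ℕ → Carrier
  boundary k m = q * q^ k * q^ k * q^ k * central m (suc k) - q^ k * central m k

  -- `central-pascal` brings row m + 1 down to m. The entries k, ..., k + 3 are then linked by three
  -- instances of `central-ratio`, which remove those at k + 1 and k + 2.
  central-recurrence : ∀ m k →
    q * (q^ m * central m k) - q * q * q * q^ suc k * q^ suc k * q^ suc k * q^ suc k * (q^ m * central m (3 ℕ.+ k))
      ≈ boundary (suc k) m - boundary (suc k) (suc m)
  central-recurrence m k =
    modulo (central-pascal m k) (- K)
    (modulo (central-pascal m (suc k)) (q * K * K * K)
    (modulo (central-ratio m k) (- q)
    (modulo (central-ratio m (suc k)) (q * K * K)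
    (modulo (central-ratio m (suc (suc k))) (q * q * q^ m * K * K * K)
    (solve 9 (λ q Q K₀ x y z w y⁺ z⁺ → let K = q :* K₀ in
       q :* (Q :* x) :- q :* q :* q :* K :* K :* K :* K :* (Q :* w)
       := ((q :* K :* K :* K :* z :- K :* y) :- (q :* K :* K :* K :* z⁺ :- K :* y⁺))
         :+ :- K :* (y⁺ :- (x :+ Q :* K :* (:1 :+ q) :* y :+ q :* q :* Q :* Q :* K :* K :* z))
         :+ q :* K :* K :* K :* (z⁺ :- (y :+ Q :* (q :* K) :* (:1 :+ q) :* z :+ q :* q :* Q :* Q :* (q :* K) :* (q :* K) :* w))
         :+ :- q :* ((K₀ :- Q) :* x :- K₀ :* (:1 :- q :* Q :* K₀) :* y)
         :+ q :* K :* K :* ((K :- Q) :* y :- K :* (:1 :- q :* Q :* K) :* z)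
         :+ q :* q :* Q :* K :* K :* K :* ((q :* K :- Q) :* z :- q :* K :* (:1 :- q :* Q :* (q :* K)) :* w))
      refl q (q^ m) (q^ k) (central m k) (central m (suc k)) (central m (suc (suc k))) (central m (3 ℕ.+ k))
        (central (suc m) (suc k)) (central (suc m) (suc (suc k))))))))
    where
    K : Carrier
    K = q^ suc k

  -- A rearrangement of `central-ratio`. It spends one of the two factors q^m of the summand of H;
  -- the other becomes the weight in `central-sum`.
  ballot-central : ∀ m k → q^ m * ballot m k ≈ q^ k * (central m k - central m (suc k))
  ballot-central m k =
    modulo (central-ratio m k) (- 1#)
    (modulo (pow-+ q k k) (- (q^ m * q * central m (suc k)))
    (solve 6 (λ q Q K KK x y → Q :* (x :- q :* KK :* y) := K :* (x :- y)
        :+ :- :1 :* ((K :- Q) :* x :- K :* (:1 :- q :* Q :* K) :* y)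
        :+ :- (Q :* q :* y) :* (KK :- K :* K))
      refl q (q^ m) (q^ k) (q^ (k ℕ.+ k)) (central m k) (central m (suc k))))

  central-sum : ℕ → ℕ → Carrier
  central-sum N k = Σ< N (λ m → q^ m * central m k)

  central-sum-zero : ∀ {N k} → N ≤ k → central-sum N k ≈ 0#
  central-sum-zero {N} {k} N≤k =
    sum-zero N (λ m m<N → trans (*-congˡ (central-zero (ℕ.<-≤-trans m<N N≤k))) (zeroʳ _))

  central-sum-recurrence : ∀ N k → let K = q^ suc k in
    q * central-sum N k - q * q * q * K * K * K * K * central-sum N (3 ℕ.+ k)
      ≈ K * central N (suc k) - q * K * K * K * central N (suc (suc k))
  central-sum-recurrence N k = begin
    q * central-sum N k - κ * central-sum N (3 ℕ.+ k)
      ≈⟨ solve 4 (λ a b x y → a :* x :- b :* y := a :* x :+ :- b :* y) refl _ _ _ _ ⟩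
    q * central-sum N k + - κ * central-sum N (3 ℕ.+ k)
      ≈⟨ +-cong (sum-*ˡ N _ _) (sum-*ˡ N _ _) ⟩
    Σ< N (λ m → q * (q^ m * central m k)) + Σ< N (λ m → - κ * (q^ m * central m (3 ℕ.+ k)))
      ≈⟨ sum-+ N _ _ ⟨
    Σ< N (λ m → q * (q^ m * central m k) + - κ * (q^ m * central m (3 ℕ.+ k)))
      ≈⟨ sum-cong N (λ m _ → trans (solve 3 (λ x b y → x :+ :- b :* y := x :- b :* y) refl _ _ _) (central-recurrence m k)) ⟩
    Σ< N (λ m → boundary (suc k) m - boundary (suc k) (suc m))
      ≈⟨ sum-telescope N (boundary (suc k)) ⟩
    boundary (suc k) 0 - boundary (suc k) N
      -- At m = 0 the boundary term only has entries of row 0 off the diagonal, which reduce to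
      -- `0#`.
      ≈⟨ solve 4 (λ a b x y → (a :* :0 :- b :* :0) :- (a :* x :- b :* y) := b :* y :- a :* x) refl _ _ _ _ ⟩
    K * central N (suc k) - q * K * K * K * central N (suc (suc k)) ∎
    where
    K κ : Carrier
    K = q^ suc k
    κ = q * q * q * K * K * K * K

  ballot-sum : ∀ N k → Σ< N (λ m → q^ (2 ℕ.* m) * ballot m k) ≈ q^ k * (central-sum N k - central-sum N (suc k))
  ballot-sum N k = begin
    Σ< N (λ m → q^ (2 ℕ.* m) * ballot m k)
      ≈⟨ sum-cong N (λ m _ → term m) ⟩
    Σ< N (λ m → q^ k * (q^ m * central m k + - 1# * (q^ m * central m (suc k))))
      ≈⟨ sum-*ˡ N _ _ ⟨
    q^ k * Σ< N (λ m → q^ m * central m k + - 1# * (q^ m * central m (suc k)))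
      ≈⟨ *-congˡ (trans (sum-+ N _ _) (+-congˡ (sym (sum-*ˡ N _ _)))) ⟩
    q^ k * (central-sum N k + - 1# * central-sum N (suc k))
      ≈⟨ solve 3 (λ a x y → a :* (x :+ :- :1 :* y) := a :* (x :- y)) refl _ _ _ ⟩
    q^ k * (central-sum N k - central-sum N (suc k)) ∎
    where
    term : ∀ m → q^ (2 ℕ.* m) * ballot m k ≈ q^ k * (q^ m * central m k + - 1# * (q^ m * central m (suc k)))
    term m = begin
      q^ (2 ℕ.* m) * ballot m k
        ≈⟨ *-congʳ (trans (pow-+ q m _) (*-congˡ (q^-cong (ℕ.+-identityʳ m)))) ⟩
      q^ m * q^ m * ballot m k
        ≈⟨ trans (*-assoc _ _ _) (*-congˡ (ballot-central m k)) ⟩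
      q^ m * (q^ k * (central m k - central m (suc k)))
        ≈⟨ solve 4 (λ m k x y → m :* (k :* (x :- y)) := k :* (m :* x :+ :- :1 :* (m :* y))) refl _ _ _ _ ⟩
      q^ k * (q^ m * central m k + - 1# * (q^ m * central m (suc k))) ∎

-- Evaluation at a primitive root of unity.

parity : ∀ n → ∃[ h ] (n ≡ h ℕ.+ h ⊎ n ≡ suc (h ℕ.+ h))
parity zero    = 0 , inj₁ ≡.refl
parity (suc n) with parity n
... | h , inj₁ ≡.refl = h , inj₂ ≡.refl
... | h , inj₂ ≡.refl = suc h , inj₁ (≡.cong suc (≡.sym (ℕ.+-suc h h)))

module AtRootOfUnity {c ℓ : Level} (R : CommutativeRing c ℓ) (domain : IsIntegralDomain R)
  (q : CommutativeRing.Carrier R) (N₀ : ℕ) (root : IsPrimitiveRoot R (suc N₀) q) where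
  open CommutativeRing R hiding (zero)
  open AbelianGroupProperties +-abelianGroup using (inverseʳ-unique; x∙y⁻¹≈ε⇒x≈y)
  open DifferenceSolver R
  open GaussianBinomials R q
  open Sums R
  open BaileyChain R q
  open PentagonalSequence R q
  open CentralSums R q
  open SetoidReasoning setoid
  open ℕ-Solver.+-*-Solver using () renaming (solve to ℕ-solve; _:+_ to _⊕_; _:*_ to _⊛_; _:=_ to _⊜_; con to ℕ-con)

  N : ℕ
  N = suc N₀

  q^N : q^ N ≈ 1#
  q^N = proj₁ root

  q^-multiple : ∀ n → q^ (n ℕ.* N) ≈ 1#
  q^-multiple zero    = refl
  q^-multiple (suc n) = trans (pow-+ q N (n ℕ.* N)) (trans (*-cong q^N (q^-multiple n)) (*-identityˡ 1#))

  -- The inverse of q^n is q^(n N₀), because q^(nN) = 1.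
  q^-cancelˡ : ∀ n {x y} → q^ n * x ≈ q^ n * y → x ≈ y
  q^-cancelˡ n {x} {y} eq = begin
    x                              ≈⟨ unit x ⟩
    q^ (n ℕ.* N₀) * (q^ n * x)     ≈⟨ *-congˡ eq ⟩
    q^ (n ℕ.* N₀) * (q^ n * y)     ≈⟨ unit y ⟨
    y                              ∎
    where
    unit : ∀ z → z ≈ q^ (n ℕ.* N₀) * (q^ n * z)
    unit z = begin
      z                               ≈⟨ *-identityˡ z ⟨
      1# * z                          ≈⟨ *-congʳ (q^-multiple n) ⟨
      q^ (n ℕ.* N) * z                ≈⟨ *-congʳ (q^-cong (≡.trans (ℕ.*-suc n N₀) (ℕ.+-comm n _))) ⟩
      q^ (n ℕ.* N₀ ℕ.+ n) * z         ≈⟨ *-congʳ (pow-+ q (n ℕ.* N₀) n) ⟩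
      q^ (n ℕ.* N₀) * q^ n * z        ≈⟨ *-assoc _ _ _ ⟩
      q^ (n ℕ.* N₀) * (q^ n * z)      ∎

  1-q^≉0 : ∀ {k} → 0 < k → k < N → ¬ (1# - q^ k ≈ 0#)
  1-q^≉0 {k} 0<k k<N 1-q^k≈0 = proj₂ root k 0<k k<N (sym (x∙y⁻¹≈ε⇒x≈y _ _ 1-q^k≈0))

  -- Absorption multiplies b(N,k) by 1 - q^(N+k) = 1 - q^k, nonzero by primitivity, and produces the
  -- factor 1 - q^(2N) = 0; a domain allows the conclusion.
  central-vanishes : ∀ k → 0 < k → k < N → central N k ≈ 0#
  central-vanishes k 0<k k<N with proj₂ domain (1# - q^ suc (N₀ ℕ.+ k)) (central N k) product≈0
    where
    product≈0 : (1# - q^ suc (N₀ ℕ.+ k)) * central N k ≈ 0#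
    product≈0 = begin
      (1# - q^ suc (N₀ ℕ.+ k)) * central N k
        ≈⟨ binom-absorb (N₀ ℕ.+ k) (N ℕ.∸ k) (≡.trans (ℕ.+-assoc N₀ k _) (≡.cong (N₀ ℕ.+_) (ℕ.m+[n∸m]≡n (ℕ.<⇒≤ k<N)))) ⟩
      (1# - q^ (N ℕ.+ N)) * [ N₀ ℕ.+ N , N₀ ℕ.+ k ]
        ≈⟨ *-congʳ (+-congˡ (-‿cong (trans (pow-+ q N N) (trans (*-cong q^N q^N) (*-identityˡ 1#))))) ⟩
      (1# - 1#) * [ N₀ ℕ.+ N , N₀ ℕ.+ k ]
        ≈⟨ solve 1 (λ x → (:1 :- :1) :* x := :0) refl _ ⟩
      0# ∎
  ... | inj₂ central≈0 = central≈0
  ... | inj₁ 1-q^≈0 = contradiction (trans (+-congˡ (-‿cong (sym q^N+k))) 1-q^≈0) (1-q^≉0 0<k k<N)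
    where
    q^N+k : q^ (N ℕ.+ k) ≈ q^ k
    q^N+k = trans (pow-+ q N k) (trans (*-congʳ q^N) (*-identityˡ _))

  -- The two powers express q^(i²-i+1) without subtraction. For i = 1 and i = 2 the sum at k + 3 is
  -- zero, and b(N,N) = 1 is respectively the first and the second entry on the right of the
  -- recurrence. For i ≥ 3 both entries vanish, and the recurrence leads back to i - 3.
  central-sum-v : ∀ i k → i ℕ.+ k ≡ N → q^ suc (i ℕ.* i) * central-sum N k ≈ q^ i * v i
  central-sum-v 0 k ≡.refl = begin
    q^ 1 * central-sum N N      ≈⟨ *-congˡ (central-sum-zero {N} ℕ.≤-refl) ⟩
    q^ 1 * 0#                   ≈⟨ solve 1 (λ x → x :* :0 := :1 :* :0) refl _ ⟩
    1# * 0#                     ∎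
  central-sum-v 1 k ≡.refl =
    modulo (central-sum-recurrence N N₀) q
    (modulo (central-sum-zero {N} {3 ℕ.+ N₀} (ℕ.m≤n+m N 2)) (q * q * q * q * K * K * K * K)
    (modulo (binom-diagonal (N ℕ.+ N)) (q * K)
    (modulo (central-zero {N} (ℕ.n<1+n N)) (- (q * q * K * K * K))
    (modulo q^N q
    (solve 6 (λ q K x y z w →
       q :* (q :* :1) :* x
       := q :* :1 :* :1
         :+ q :* ((q :* x :- q :* q :* q :* K :* K :* K :* K :* y) :- (K :* z :- q :* K :* K :* K :* w))
         :+ q :* q :* q :* q :* K :* K :* K :* K :* (y :- :0)
         :+ q :* K :* (z :- :1)
         :+ :- (q :* q :* K :* K :* K) :* (w :- :0)
         :+ q :* (K :- :1))
      refl q K (central-sum N N₀) (central-sum N (3 ℕ.+ N₀)) (central N N) (central N (suc N)))))))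
    where
    K : Carrier
    K = q^ N
  central-sum-v 2 k ≡.refl =
    modulo (central-sum-recurrence N k) (q * q * q * q)
    (modulo (central-sum-zero {N} {3 ℕ.+ k} (ℕ.n≤1+n N)) (q * q * q * q * q * q * q * K * K * K * K)
    (modulo (central-vanishes (suc k) (s≤s z≤n) (ℕ.n<1+n (suc k))) (q * q * q * q * K)
    (modulo (binom-diagonal (N ℕ.+ N)) (- (q * q * q * q * q * K * K * K))
    (modulo q^N (- (q * q * (1# + q * K + q * K * (q * K))))
    (solve 6 (λ q K x y z w →
       q :* (q :* (q :* (q :* (q :* :1)))) :* x
       := q :* (q :* :1) :* :- :1
         :+ q :* q :* q :* q :* ((q :* x :- q :* q :* q :* K :* K :* K :* K :* y) :- (K :* z :- q :* K :* K :* K :* w))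
         :+ q :* q :* q :* q :* q :* q :* q :* K :* K :* K :* K :* (y :- :0)
         :+ q :* q :* q :* q :* K :* (z :- :0)
         :+ :- (q :* q :* q :* q :* q :* K :* K :* K) :* (w :- :1)
         :+ :- (q :* q :* (:1 :+ q :* K :+ q :* K :* (q :* K))) :* (q :* K :- :1))
      refl q K (central-sum N k) (central-sum N (3 ℕ.+ k)) (central N (suc k)) (central N N))))))
    where
    K : Carrier
    K = q^ suc k
  central-sum-v (suc (suc (suc i))) k i+3+k≡N =
    modulo (trans (q^-cong (ℕ-solve 1 (λ i → ℕ-con 1 ⊕ (ℕ-con 3 ⊕ i) ⊛ (ℕ-con 3 ⊕ i)
              ⊜ ℕ-con 1 ⊕ i ⊛ i ⊕ (i ⊕ (i ⊕ (i ⊕ (i ⊕ (i ⊕ (i ⊕ ℕ-con 9))))))) ≡.refl i))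
       expand) x
    (modulo (central-sum-recurrence N k) (I * (A * A * A * A * A * A) * q⁸)
    (modulo (central-vanishes (suc k) (s≤s z≤n) k+1<N) (I * (A * A * A * A * A * A) * q⁸ * K)
    (modulo (central-vanishes (suc (suc k)) (s≤s z≤n) k+2<N) (- (I * (A * A * A * A * A * A) * q⁸ * q * K * K * K))
    -- The recurrence carries the fourth power of q^(k+1), so q² q^i q^(k+1) = q^N = 1 is raised to
    -- the fourth power as well.
    (modulo (pow-cong 4 unit) (q * q * q * A * A * I * y)
    (modulo (central-sum-v i (3 ℕ.+ k) i+[3+k]≡N) (q * q * q * A * A)
    (modulo (pow-+ q i i) (- (q * q * q * A * V))
    (solve 11 (λ q A K I J x y z w V B → let q⁸ = q :* q :* q :* q :* q :* q :* q :* q ; A⁶ = A :* A :* A :* A :* A :* A ; U = q :* (q :* (A :* K)) in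
       J :* x
       := q :* (q :* (q :* A)) :* (B :* V)
         :+ x :* (J :- I :* (A :* (A :* (A :* (A :* (A :* (A :* (q :* (q :* (q :* (q :* (q :* (q :* (q :* (q :* (q :* :1))))))))))))))))
         :+ I :* A⁶ :* q⁸ :* ((q :* x :- q :* q :* q :* K :* K :* K :* K :* y) :- (K :* z :- q :* K :* K :* K :* w))
         :+ I :* A⁶ :* q⁸ :* K :* (z :- :0)
         :+ :- (I :* A⁶ :* q⁸ :* q :* K :* K :* K) :* (w :- :0)
         :+ q :* q :* q :* A :* A :* I :* y :* (U :* (U :* (U :* (U :* :1))) :- :1 :* (:1 :* (:1 :* (:1 :* :1))))
         :+ q :* q :* q :* A :* A :* (I :* y :- A :* V)
         :+ :- (q :* q :* q :* A :* V) :* (B :- A :* A))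
      refl q A K I (q^ suc ((3 ℕ.+ i) ℕ.* (3 ℕ.+ i))) x y (central N (suc k)) (central N (suc (suc k))) V (q^ (i ℕ.+ i)))))))))
    where
    A K I V x y q⁸ : Carrier
    A = q^ i
    K = q^ suc k
    I = q^ suc (i ℕ.* i)
    V = v i
    x = central-sum N k
    y = central-sum N (3 ℕ.+ k)
    q⁸ = q * q * q * q * q * q * q * q
    expand : q^ (1 ℕ.+ i ℕ.* i ℕ.+ (i ℕ.+ (i ℕ.+ (i ℕ.+ (i ℕ.+ (i ℕ.+ (i ℕ.+ 9))))))) ≈ I * (A * (A * (A * (A * (A * (A * q^ 9))))))
    expand = trans (pow-+ q (suc (i ℕ.* i)) _) (*-congˡ (A+ _ (A+ _ (A+ _ (A+ _ (A+ _ (pow-+ q i 9)))))))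
      where
      A+ : ∀ n {y} → q^ n ≈ y → q^ (i ℕ.+ n) ≈ A * y
      A+ n q^n≈y = trans (pow-+ q i n) (*-congˡ q^n≈y)
    unit : q * (q * (A * K)) ≈ 1#
    unit = begin
      q * (q * (A * K))               ≈⟨ *-congˡ (*-congˡ (pow-+ q i (suc k))) ⟨
      q^ (2 ℕ.+ (i ℕ.+ suc k))        ≈⟨ q^-cong (≡.cong (2 ℕ.+_) (ℕ.+-suc i k)) ⟩
      q^ (3 ℕ.+ i ℕ.+ k)              ≈⟨ q^-cong i+3+k≡N ⟩
      q^ N                            ≈⟨ q^N ⟩
      1#                              ∎
    i+[3+k]≡N : i ℕ.+ (3 ℕ.+ k) ≡ N
    i+[3+k]≡N = ≡.trans (ℕ-solve 2 (λ i k → i ⊕ (ℕ-con 3 ⊕ k) ⊜ ℕ-con 3 ⊕ i ⊕ k) ≡.refl i k) i+3+k≡N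
    k+2<N : suc (suc k) < N
    k+2<N = ≡.subst (3 ℕ.+ k ≤_) i+[3+k]≡N (ℕ.m≤n+m (3 ℕ.+ k) i)
    k+1<N : suc k < N
    k+1<N = ℕ.<-trans (ℕ.n<1+n (suc k)) k+2<N

  -- For k = N - 1 - i the exponents agree modulo N. Adding (2i + 1)N on one side and N² on the
  -- other makes the congruence an equation between natural numbers.
  reflection : ∀ i k → i ℕ.+ suc k ≡ N → q^ (k ℕ.* suc k) ≈ q^ (i ℕ.* suc i)
  reflection i k i+1+k≡N = begin
    q^ (k ℕ.* suc k)
      ≈⟨ trans (*-congˡ (q^-multiple (suc (i ℕ.+ i)))) (*-identityʳ _) ⟨
    q^ (k ℕ.* suc k) * q^ (suc (i ℕ.+ i) ℕ.* N)
      ≈⟨ pow-+ q (k ℕ.* suc k) _ ⟨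
    q^ (k ℕ.* suc k ℕ.+ suc (i ℕ.+ i) ℕ.* N)
      ≈⟨ q^-cong (≡.subst (λ n → k ℕ.* suc k ℕ.+ suc (i ℕ.+ i) ℕ.* n ≡ i ℕ.* suc i ℕ.+ n ℕ.* n) i+1+k≡N (exponent i k)) ⟩
    q^ (i ℕ.* suc i ℕ.+ N ℕ.* N)
      ≈⟨ pow-+ q (i ℕ.* suc i) _ ⟩
    q^ (i ℕ.* suc i) * q^ (N ℕ.* N)
      ≈⟨ trans (*-congˡ (q^-multiple N)) (*-identityʳ _) ⟩
    q^ (i ℕ.* suc i) ∎
    where
    exponent : ∀ i k → k ℕ.* suc k ℕ.+ suc (i ℕ.+ i) ℕ.* (i ℕ.+ suc k) ≡ i ℕ.* suc i ℕ.+ (i ℕ.+ suc k) ℕ.* (i ℕ.+ suc k)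
    exponent = ℕ-solve 2 (λ i k → k ⊛ (ℕ-con 1 ⊕ k) ⊕ (ℕ-con 1 ⊕ (i ⊕ i)) ⊛ (i ⊕ (ℕ-con 1 ⊕ k))
      ⊜ i ⊛ (ℕ-con 1 ⊕ i) ⊕ (i ⊕ (ℕ-con 1 ⊕ k)) ⊛ (i ⊕ (ℕ-con 1 ⊕ k))) ≡.refl

  -- `central-sum-v` at i + 1 and at i evaluates the two sums, and their difference takes the form
  -- of `alpha-v`. The factor q^(i+1), cancelled at once, keeps all exponents nonnegative.
  central-sum-alpha : ∀ i k → i ℕ.+ suc k ≡ N →
    q^ (k ℕ.* suc k) * q * (central-sum N k - central-sum N (suc k)) ≈ alpha R q i
  central-sum-alpha i k i+1+k≡N = q^-cancelˡ (suc i) (begin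
    q^ suc i * (q^ (k ℕ.* suc k) * q * (x - y))
      ≈⟨ *-congˡ (*-congʳ (*-congʳ (reflection i k i+1+k≡N))) ⟩
    q^ suc i * (q^ (i ℕ.* suc i) * q * (x - y))
      ≈⟨ modulo (trans (q^-cong (ℕ.*-suc i i)) (pow-+ q i (i ℕ.* i))) (q^ suc i * q * (x - y))
         (modulo (q^-square i) (- (q * x))
         (modulo (central-sum-v (suc i) k (≡.trans (≡.sym (ℕ.+-suc i k)) i+1+k≡N)) 1#
         (modulo (central-sum-v i (suc k) i+1+k≡N) (- (q * q^ i * q^ i))
         (modulo (pow-+ q i i) (q * q^ i * v i)
         (solve 10 (λ q A I J L B x y v v⁺ →
            q :* A :* (L :* q :* (x :- y))
            := q :* A :* (v⁺ :- B :* v)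
              :+ q :* A :* q :* (x :- y) :* (L :- A :* I)
              :+ :- (q :* x) :* (J :- q :* (I :* A :* A))
              :+ :1 :* (q :* J :* x :- q :* A :* v⁺)
              :+ :- (q :* A :* A) :* (q :* I :* y :- A :* v)
              :+ q :* A :* v :* (B :- A :* A))
          refl q (q^ i) (q^ (i ℕ.* i)) (q^ (suc i ℕ.* suc i)) (q^ (i ℕ.* suc i)) (q^ (i ℕ.+ i)) x y (v i) (v (suc i))))))) ⟩
    q^ suc i * (v (suc i) - q^ (i ℕ.+ i) * v i)
      ≈⟨ *-congˡ (alpha-v i) ⟨
    q^ suc i * alpha R q i ∎)
    where
    x y : Carrier
    x = central-sum N k
    y = central-sum N (suc k)

  -- q^(N/2) is a square root of 1 other than 1, hence -1 in a domain.
  q^-half : ∀ h → N ≡ suc h ℕ.+ suc h → q^ suc h ≈ - 1#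
  q^-half h N≡ with proj₂ domain (1# - q^ suc h) (1# + q^ suc h) product≈0
    where
    product≈0 : (1# - q^ suc h) * (1# + q^ suc h) ≈ 0#
    product≈0 = modulo (trans (sym (pow-+ q (suc h) (suc h))) (trans (q^-cong (≡.sym N≡)) q^N)) (- 1#)
      (solve 1 (λ x → (:1 :- x) :* (:1 :+ x) := :0 :+ :- :1 :* (x :* x :- :1)) refl _)
  ... | inj₁ 1-q^≈0 = contradiction 1-q^≈0 (1-q^≉0 (s≤s z≤n) (≡.subst (suc h <_) (≡.sym N≡) (ℕ.m<m+n (suc h) (s≤s z≤n))))
  ... | inj₂ 1+q^≈0 = inverseʳ-unique 1# (q^ suc h) 1+q^≈0

  -- (−1)^k q^(k(k+1)/2)
  sign-triangular : ℕ → Carrier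
  sign-triangular k = unit-weight k * q^ k

  sign-triangular-suc : ∀ k → sign-triangular (suc k) ≈ - (q^ suc k * sign-triangular k)
  sign-triangular-suc k = solve 3 (λ q K u → :- (K :* u) :* (q :* K) := :- (q :* K :* (u :* K))) refl q (q^ k) (unit-weight k)

  sign-triangular-even : ∀ h → sign-triangular (h ℕ.+ h) ≈ q^ (h ℕ.* suc (h ℕ.+ h))
  sign-triangular-even zero    = *-identityˡ 1#
  sign-triangular-even (suc h) = begin
    sign-triangular (suc (h ℕ.+ suc h))
      ≈⟨ reflexive (≡.cong sign-triangular (≡.cong suc (ℕ.+-suc h h))) ⟩
    sign-triangular (suc (suc (h ℕ.+ h)))
      ≈⟨ trans (sign-triangular-suc n₁) (-‿cong (*-congˡ (sign-triangular-suc (h ℕ.+ h)))) ⟩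
    - (q^ n₂ * - (q^ n₁ * sign-triangular (h ℕ.+ h)))
      ≈⟨ solve 3 (λ x y z → :- (x :* :- (y :* z)) := x :* (y :* z)) refl _ _ _ ⟩
    q^ n₂ * (q^ n₁ * sign-triangular (h ℕ.+ h))
      ≈⟨ *-congˡ (*-congˡ (sign-triangular-even h)) ⟩
    q^ n₂ * (q^ n₁ * q^ (h ℕ.* suc (h ℕ.+ h)))
      ≈⟨ trans (*-congˡ (sym (pow-+ q n₁ _))) (sym (pow-+ q n₂ _)) ⟩
    q^ (n₂ ℕ.+ (n₁ ℕ.+ h ℕ.* suc (h ℕ.+ h)))
      ≈⟨ q^-cong (ℕ-solve 1 (λ h → ℕ-con 2 ⊕ (h ⊕ h) ⊕ (ℕ-con 1 ⊕ (h ⊕ h) ⊕ h ⊛ (ℕ-con 1 ⊕ (h ⊕ h)))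
           ⊜ (ℕ-con 1 ⊕ h) ⊛ (ℕ-con 1 ⊕ (ℕ-con 1 ⊕ h ⊕ (ℕ-con 1 ⊕ h)))) ≡.refl h) ⟩
    q^ (suc h ℕ.* suc (suc h ℕ.+ suc h)) ∎
    where
    n₁ n₂ : ℕ
    n₁ = suc (h ℕ.+ h)
    n₂ = suc (suc (h ℕ.+ h))

  -- For odd N the exponent N(N - 1)/2 is a multiple of N and the sign is +1. For even N the
  -- exponent leaves q^(N/2) = -1, which cancels the sign (-1)^(N-1).
  sign-triangular-last : sign-triangular N₀ ≈ 1#
  sign-triangular-last with parity N₀
  ... | h , inj₁ N₀≡ = begin
    sign-triangular N₀                ≈⟨ reflexive (≡.cong sign-triangular N₀≡) ⟩
    sign-triangular (h ℕ.+ h)         ≈⟨ sign-triangular-even h ⟩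
    q^ (h ℕ.* suc (h ℕ.+ h))          ≈⟨ q^-cong (≡.cong (λ n → h ℕ.* suc n) N₀≡) ⟨
    q^ (h ℕ.* N)                      ≈⟨ q^-multiple h ⟩
    1#                                ∎
  ... | h , inj₂ N₀≡ = begin
    sign-triangular N₀
      ≈⟨ reflexive (≡.cong sign-triangular N₀≡) ⟩
    sign-triangular (suc (h ℕ.+ h))
      ≈⟨ trans (sign-triangular-suc (h ℕ.+ h)) (-‿cong (*-congˡ (sign-triangular-even h))) ⟩
    - (q^ suc (h ℕ.+ h) * q^ (h ℕ.* suc (h ℕ.+ h)))
      ≈⟨ -‿cong (pow-+ q (suc (h ℕ.+ h)) _) ⟨
    - (q^ (suc (h ℕ.+ h) ℕ.+ h ℕ.* suc (h ℕ.+ h)))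
      ≈⟨ -‿cong (q^-cong (ℕ-solve 1 (λ h → ℕ-con 1 ⊕ (h ⊕ h) ⊕ h ⊛ (ℕ-con 1 ⊕ (h ⊕ h)) ⊜ ℕ-con 1 ⊕ h ⊕ h ⊛ (ℕ-con 1 ⊕ (ℕ-con 1 ⊕ (h ⊕ h)))) ≡.refl h)) ⟩
    - (q^ (suc h ℕ.+ h ℕ.* suc (suc (h ℕ.+ h))))
      ≈⟨ -‿cong (q^-cong (≡.cong (λ n → suc h ℕ.+ h ℕ.* suc n) N₀≡)) ⟨
    - (q^ (suc h ℕ.+ h ℕ.* N))
      ≈⟨ -‿cong (trans (pow-+ q (suc h) _) (*-cong (q^-half h N≡) (q^-multiple h))) ⟩
    - (- 1# * 1#)
      ≈⟨ solve 0 (:- (:- :1 :* :1) := :1) refl ⟩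
    1# ∎
    where
    N≡ : N ≡ suc h ℕ.+ suc h
    N≡ = ≡.cong suc (≡.trans N₀≡ (≡.sym (ℕ.+-suc h h)))

  -- The value is 1 at both ends, and the step ratios at mirrored places, -q^(i+1) and -q^(k+1),
  -- have product q^N = 1.
  sign-triangular-palindrome : ∀ i k → i ℕ.+ suc k ≡ N → sign-triangular i ≈ sign-triangular k
  sign-triangular-palindrome i zero i+1≡N = begin
    sign-triangular i     ≈⟨ reflexive (≡.cong sign-triangular (ℕ.suc-injective (≡.trans (ℕ.+-comm 1 i) i+1≡N))) ⟩
    sign-triangular N₀    ≈⟨ sign-triangular-last ⟩
    1#                    ≈⟨ *-identityˡ 1# ⟨
    sign-triangular 0     ∎
  sign-triangular-palindrome i (suc k) i+2+k≡N = sym (begin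
    sign-triangular (suc k)
      ≈⟨ sign-triangular-suc k ⟩
    - (q^ suc k * sign-triangular k)
      ≈⟨ -‿cong (*-congˡ (sign-triangular-palindrome (suc i) k (≡.trans (≡.sym (ℕ.+-suc i (suc k))) i+2+k≡N))) ⟨
    - (q^ suc k * sign-triangular (suc i))
      ≈⟨ -‿cong (*-congˡ (sign-triangular-suc i)) ⟩
    - (q^ suc k * - (q^ suc i * sign-triangular i))
      ≈⟨ solve 3 (λ x y z → :- (x :* :- (y :* z)) := y :* x :* z) refl _ _ _ ⟩
    q^ suc i * q^ suc k * sign-triangular i
      ≈⟨ *-congʳ (trans (sym (pow-+ q (suc i) (suc k))) (trans (q^-cong (≡.trans (≡.sym (ℕ.+-suc i (suc k))) i+2+k≡N)) q^N)) ⟩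
    1# * sign-triangular i
      ≈⟨ *-identityˡ _ ⟩
    sign-triangular i ∎)

  sign-triangular-closed : ∀ i → sign-triangular i ≈ sgn R i * q^ ((i ℕ.* suc i) ℕ./ 2)
  sign-triangular-closed zero    = refl
  sign-triangular-closed (suc i) = begin
    sign-triangular (suc i)
      ≈⟨ sign-triangular-suc i ⟩
    - (q^ suc i * sign-triangular i)
      ≈⟨ -‿cong (*-congˡ (sign-triangular-closed i)) ⟩
    - (q^ suc i * (sgn R i * q^ t))
      ≈⟨ solve 3 (λ x y z → :- (x :* (y :* z)) := :- y :* (z :* x)) refl _ _ _ ⟩
    - sgn R i * (q^ t * q^ suc i)
      ≈⟨ *-congˡ (trans (sym (pow-+ q t (suc i))) (q^-cong (≡.sym half))) ⟩
    - sgn R i * q^ ((suc i ℕ.* suc (suc i)) ℕ./ 2) ∎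
    where
    t : ℕ
    t = (i ℕ.* suc i) ℕ./ 2
    half : (suc i ℕ.* suc (suc i)) ℕ./ 2 ≡ t ℕ.+ suc i
    half = ≡.trans (ℕ./-congˡ {o = 2} (ℕ-solve 1 (λ i → (ℕ-con 1 ⊕ i) ⊛ (ℕ-con 2 ⊕ i) ⊜ i ⊛ (ℕ-con 1 ⊕ i) ⊕ (ℕ-con 1 ⊕ i) ⊛ ℕ-con 2) ≡.refl i))
      (≡.trans (ℕ.+-distrib-/-∣ʳ (i ℕ.* suc i) (ℕ.n∣m*n (suc i) {2})) (≡.cong (t ℕ.+_) (ℕ.m*n/n≡m (suc i) 2)))

  poch-vanishes : ∀ x n j → j < n → x * q^ j ≈ 1# → ⟨ x ⟩ n ≈ 0#
  poch-vanishes x (suc n) j j≤n xq^j≈1 with ℕ.m≤n⇒m<n∨m≡n (ℕ.≤-pred j≤n)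
  ... | inj₁ j<n    = trans (*-congʳ (poch-vanishes x n j j<n xq^j≈1)) (zeroˡ _)
  ... | inj₂ ≡.refl = trans (*-congˡ (trans (+-congˡ (-‿cong xq^j≈1)) (-‿inverseʳ 1#))) (zeroʳ _)

  -- The m ≥ N consecutive exponents m + 1, ..., 2m include a multiple of N; `j` is the offset of
  -- the first one.
  poch-vanishes-beyond : ∀ m → N ≤ m → ⟨ q^ suc m ⟩ m ≈ 0#
  poch-vanishes-beyond m N≤m = poch-vanishes (q^ suc m) m j (ℕ.<-≤-trans (s≤s (ℕ.m∸n≤m N₀ (m ℕ.% N))) N≤m) (begin
    q^ suc m * q^ j              ≈⟨ pow-+ q (suc m) j ⟨
    q^ (suc m ℕ.+ j)             ≈⟨ q^-cong exponent ⟩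
    q^ (suc (m ℕ./ N) ℕ.* N)     ≈⟨ q^-multiple (suc (m ℕ./ N)) ⟩
    1#                           ∎)
    where
    j : ℕ
    j = N₀ ℕ.∸ m ℕ.% N
    exponent : suc m ℕ.+ j ≡ suc (m ℕ./ N) ℕ.* N
    exponent = ≡.trans (≡.cong (λ x → suc x ℕ.+ j) (ℕ.m≡m%n+[m/n]*n m N))
      (≡.trans (ℕ-solve 3 (λ x y j → ℕ-con 1 ⊕ (x ⊕ y) ⊕ j ⊜ ℕ-con 1 ⊕ (x ⊕ j) ⊕ y) ≡.refl (m ℕ.% N) (m ℕ./ N ℕ.* N) j)
      (≡.cong (λ x → suc x ℕ.+ m ℕ./ N ℕ.* N) (ℕ.m+[n∸m]≡n (ℕ.≤-pred (ℕ.m%n<n m N)))))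

  Hpartial-truncate : ∀ p M → N ≤ M → Hpartial R q p M ≈ Hpartial R q p N
  Hpartial-truncate p M N≤M = sum-truncate N≤M (λ m N≤m →
    trans (*-congʳ (trans (*-congˡ (poch-vanishes-beyond m N≤m)) (zeroʳ _))) (zeroˡ _))

  Hpartial-rhsSum : ∀ j → q * Hpartial R q (suc j) N ≈ rhsSum R q (suc j) N
  Hpartial-rhsSum j = begin
    q * Σ< N (λ m → q^ (2 ℕ.* m) * ⟨ q^ suc m ⟩ m * inner R q j m)
      ≈⟨ *-congˡ (sum-cong N (λ m m<N → trans (*-assoc _ _ _) (trans (*-congˡ (inner-expansion j m m<N)) (sum-*ˡ N _ _)))) ⟩
    q * Σ< N (λ m → Σ< N (λ k → q^ (2 ℕ.* m) * (w k * ballot m k)))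
      ≈⟨ *-congˡ (sum-swap N N _) ⟩
    q * Σ< N (λ k → Σ< N (λ m → q^ (2 ℕ.* m) * (w k * ballot m k)))
      ≈⟨ *-congˡ (sum-cong N (λ k _ → trans (sum-cong N (λ m _ → solve 3 (λ x y z → x :* (y :* z) := y :* (x :* z)) refl _ _ _))
                                     (trans (sym (sum-*ˡ N _ _)) (*-congˡ (ballot-sum N k))))) ⟩
    q * Σ< N (λ k → w k * (q^ k * X k))
      ≈⟨ sum-*ˡ N _ _ ⟩
    Σ< N (λ k → q * (w k * (q^ k * X k)))
      ≈⟨ sum-reverse N (λ k i k+1+i≡N → term k i (≡.trans (ℕ.+-suc i k) (≡.trans (≡.cong suc (ℕ.+-comm i k)) (≡.trans (≡.sym (ℕ.+-suc k i)) k+1+i≡N)))) ⟩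
    rhsSum R q (suc j) N ∎
    where
    w X : ℕ → Carrier
    w k = unit-weight k * pow R (q^ (k ℕ.* suc k)) (suc j)
    X k = central-sum N k - central-sum N (suc k)
    term : ∀ k i → i ℕ.+ suc k ≡ N →
      q * (w k * (q^ k * X k)) ≈ sgn R i * q^ ((i ℕ.* suc i) ℕ./ 2 ℕ.+ j ℕ.* (i ℕ.* i ℕ.+ i)) * alpha R q i
    term k i i+1+k≡N = begin
      q * (unit-weight k * (q^ (k ℕ.* suc k) * pow R (q^ (k ℕ.* suc k)) j) * (q^ k * X k))
        -- The q^k from `ballot-sum` completes `sign-triangular k`. Of the j + 1 factors q^(k(k+1)),
        -- one goes with the outer q into α_i, and the other j = p - 1 give the exponent (p - 1)(i²
        -- + i).
        ≈⟨ solve 6 (λ q u Y Z K X → q :* (u :* (Y :* Z) :* (K :* X)) := u :* K :* Z :* (Y :* q :* X)) refl _ _ _ _ _ _ ⟩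
      sign-triangular k * pow R (q^ (k ℕ.* suc k)) j * (q^ (k ℕ.* suc k) * q * X k)
        ≈⟨ *-cong (*-cong (trans (sym (sign-triangular-palindrome i k i+1+k≡N)) (sign-triangular-closed i)) power) (central-sum-alpha i k i+1+k≡N) ⟩
      sgn R i * q^ ((i ℕ.* suc i) ℕ./ 2) * q^ (j ℕ.* (i ℕ.* i ℕ.+ i)) * alpha R q i
        ≈⟨ *-congʳ (trans (*-assoc _ _ _) (*-congˡ (sym (pow-+ q ((i ℕ.* suc i) ℕ./ 2) _)))) ⟩
      sgn R i * q^ ((i ℕ.* suc i) ℕ./ 2 ℕ.+ j ℕ.* (i ℕ.* i ℕ.+ i)) * alpha R q i ∎
      where
      power : pow R (q^ (k ℕ.* suc k)) j ≈ q^ (j ℕ.* (i ℕ.* i ℕ.+ i))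
      power = trans (pow-cong j (reflection i k i+1+k≡N))
        (trans (pow-pow q (i ℕ.* suc i) j) (q^-cong (≡.cong (j ℕ.*_) (≡.trans (ℕ.*-suc i i) (ℕ.+-comm i _)))))

theorem2p9 : ∀ {c ℓ : Level} (R : CommutativeRing c ℓ) → IsIntegralDomain R →
    (p N : ℕ) → p ≥ 1 → N ≥ 1 → (q : CommutativeRing.Carrier R) →
    IsPrimitiveRoot R N q →
    ∀ (M : ℕ) → M ≥ N →
    CommutativeRing._≈_ R (CommutativeRing._*_ R q (Hpartial R q p M)) (rhsSum R q p N)
theorem2p9 R domain (suc j) (suc N₀) _ _ q root M N≤M =
  trans (*-congˡ (Hpartial-truncate (suc j) M N≤M)) (Hpartial-rhsSum j)
  where
  open CommutativeRing R using (trans; *-congˡ)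
  open AtRootOfUnity R domain q N₀ root
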